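{- Let $G=(V,E)$ be a finite (not necessarily bipartite) simple graph whose vertices arrive in an order unknown in advance. Write $u<v$ if $u$ arrives before $v$, and $B_v=\{(uv)\in E:u<v\}$. Let $\mathbf{r}=(\mathbf{r}^v)_{v\in V}$, where the $\mathbf{r}^v$ are mutually independent random vectors in $[0,1]^{B_v}$, and let $x_{uv}=\mathbf{E}[\mathbf{r}^v_{(uv)}]$ for $(uv)\in E$, $u<v$ (symmetric in $u,v$, and $0$ for non-edges). If (i) $\sum_u x_{uv}\le 1$ for every $v\in V$, and (ii) $\sum_{u<v}\mathbf{r}^v_{(uv)}\le 1$ for every $v\in V$ and every realization of $\mathbf{r}^v\in[0,1]^{B_v}$, then $\mathbf{r}$ admits a $\tfrac12$-selectable fractional batched OCRS for matchings in $G$ in the vertex arrival model.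
   Context: Vertex arrival model: when $v$ arrives, the batch $B_v$ of edges from $v$ to previously arrived vertices is revealed, together with the realization of the random vector $\mathbf{r}^v\in[0,1]^{B_v}$. The feasible sets are the matchings of $G$. A (possibly randomized) online algorithm is a fractional batched OCRS with respect to $\mathbf{r}$ if upon arrival of each $v$ it irrevocably selects a set $I_v\subseteq B_v$ such that $I=\bigsqcup_v I_v$ is a matching. Its decision at $v$ may depend only on the batches, the realizations $\mathbf{r}^u$ and the laws of $\mathbf{r}^u$ for vertices $u$ arrived up to and including $v$, on its previous decisions and on internal randomness; it does not know the order of future arrivals. It is $c$-selectable if, for every arrival order, $\Pr[e\in I_v\mid \mathbf{r}^v=\mathbf{s}]\ge c\cdot s_e$ for all $v\in V$, (almost) all values $\mathbf{s}\in[0,1]^{B_v}$ of $\mathbf{r}^v$, and all $e\in B_v$. The arrival order is fixed by an oblivious adversary, i.e. independently of the realizations of $\mathbf{r}$ and the algorithm's randomness. -}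

module Defs where

open import Level using (0ℓ) renaming (suc to lsuc)
open import Algebra.Bundles using (CommutativeRing)
open import Algebra.Structures using (IsCommutativeRing)
open import Data.Bool.Base using (Bool; false; T; if_then_else_)
open import Data.Fin.Base using (Fin; toℕ; fromℕ<; inject≤)
import Data.Fin.Base as Fin
open import Data.Fin.Permutation using (Permutation′; _⟨$⟩ʳ_; _⟨$⟩ˡ_)
open import Data.Fin.Subset using (Subset; _∈_; _⊆_; inside; outside)
open import Data.Nat.Base using (ℕ; zero; suc)
import Data.Nat.Base as ℕ
import Data.Nat.Properties as ℕ
open import Data.Product.Base using (Σ-syntax; ∃; ∃-syntax; _×_; _,_; proj₁)
open import Data.Sum.Base using (_⊎_; inj₁; inj₂)
open import Data.Unit.Base using (⊤)
import Data.Vec.Base as Vec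
open import Data.Vec.Functional using (Vector)
open import Function.Base using (_∘_)
open import Relation.Binary.Core using (Rel)
open import Relation.Binary.Structures using (IsTotalOrder)
open import Relation.Binary.PropositionalEquality
  using (_≡_; _≢_; sym; trans; cong; subst; subst₂)
open import Relation.Nullary.Negation using (¬_)
open import Relation.Unary using (Pred; U; ∁; ⋃; ⋂; _≐_)
import Relation.Unary as Pred

module _ {X : Set} (_≤_ : Rel X 0ℓ) where

  UpperBound Supremum : ∀ {ℓ} → Pred X ℓ → Pred X ℓ
  UpperBound S b = ∀ {x} → S x → x ≤ b
  Supremum S s = UpperBound S s × (∀ {b} → UpperBound S b → s ≤ b)

-- The real numbers: a Dedekind-complete totally ordered field.  Such a field is
-- unique up to isomorphism, so quantifying over `Reals` fixes ℝ.

record Reals : Set₁ where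
  infix  4 _≤_
  infixl 6 _+_
  infixl 7 _*_
  infix  8 -_
  field
    ℝ       : Set
    _≤_     : Rel ℝ 0ℓ
    _+_ _*_ : ℝ → ℝ → ℝ
    -_      : ℝ → ℝ
    0ℝ 1ℝ   : ℝ
    isCommutativeRing : IsCommutativeRing _≡_ _+_ _*_ -_ 0ℝ 1ℝ
    isTotalOrder      : IsTotalOrder _≡_ _≤_
    +-monoˡ-≤         : ∀ z {x y} → x ≤ y → x + z ≤ y + z
    *-nonneg          : ∀ {x y} → 0ℝ ≤ x → 0ℝ ≤ y → 0ℝ ≤ x * y
    0≢1               : 0ℝ ≢ 1ℝ
    inverse           : ∀ x → x ≢ 0ℝ → ∃[ y ] x * y ≡ 1ℝ

    complete          : (S : Pred ℝ 0ℓ) → ∃ S → ∃ (UpperBound _≤_ S) →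
                        ∃ (Supremum _≤_ S)

  IsSup : ∀ {ℓ} → Pred ℝ ℓ → Pred ℝ ℓ
  IsSup = Supremum _≤_

  commutativeRing : CommutativeRing 0ℓ 0ℓ
  commutativeRing = record { isCommutativeRing = isCommutativeRing }

  open CommutativeRing commutativeRing public
    using (+-commutativeMonoid; *-commutativeMonoid)
  open import Algebra.Properties.CommutativeMonoid.Sum +-commutativeMonoid public
    using (sum)
  open import Algebra.Properties.CommutativeMonoid.Sum *-commutativeMonoid public
    using () renaming (sum to product)

  module _ where
    private
      module R = CommutativeRing commutativeRing
      module ≤ = IsTotalOrder isTotalOrder
      open import Algebra.Properties.Ring R.ring using (-‿involutive; -‿distribˡ-*)

      0≤1 : 0ℝ ≤ 1ℝ
      0≤1 with ≤.total 0ℝ 1ℝ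
      ... | inj₁ p = p
      ... | inj₂ p = subst (0ℝ ≤_) sq (*-nonneg q q)
        where
        q : 0ℝ ≤ - 1ℝ
        q = subst₂ _≤_ (R.-‿inverseʳ 1ℝ) (R.+-identityˡ (- 1ℝ)) (+-monoˡ-≤ (- 1ℝ) p)
        sq : - 1ℝ * - 1ℝ ≡ 1ℝ
        sq = trans (sym (-‿distribˡ-* 1ℝ (- 1ℝ)))
                   (trans (cong -_ (R.*-identityˡ (- 1ℝ))) (-‿involutive 1ℝ))

    2≢0 : 1ℝ + 1ℝ ≢ 0ℝ
    2≢0 eq = 0≢1 (≤.antisym 0≤1
      (subst₂ _≤_ (R.+-identityˡ 1ℝ) eq (+-monoˡ-≤ 1ℝ 0≤1)))

  ½ : ℝ
  ½ = proj₁ (inverse (1ℝ + 1ℝ) 2≢0)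

module Probability (R : Reals) where
  open Reals R

  record SigmaAlgebra (Ω : Set) : Set₂ where
    field
      Measurable : Pred (Pred Ω 0ℓ) (lsuc 0ℓ)
      resp       : ∀ {A B} → A ≐ B → Measurable A → Measurable B
      universe   : Measurable U
      complement : ∀ {A} → Measurable A → Measurable (∁ A)
      union      : {A : ℕ → Pred Ω 0ℓ} → (∀ m → Measurable (A m)) → Measurable (⋃ ℕ A)

    MeasurableFunction : Pred (Ω → ℝ) (lsuc 0ℓ)
    MeasurableFunction X = ∀ q → Measurable (λ ω → X ω ≤ q)

  open SigmaAlgebra using (Measurable; MeasurableFunction)

  -- The σ-algebra generated by a family of real-valued functions.

  data Generated {X I : Set} (f : I → X → ℝ) : Pred (Pred X 0ℓ) (lsuc 0ℓ) where
    gen   : ∀ i q → Generated f (λ x → f i x ≤ q)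
    resp  : ∀ {A B} → A ≐ B → Generated f A → Generated f B
    univ  : Generated f U
    compl : ∀ {A} → Generated f A → Generated f (∁ A)
    union : {A : ℕ → Pred X 0ℓ} → (∀ m → Generated f (A m)) → Generated f (⋃ ℕ A)

  generatedBy : {X I : Set} → (I → X → ℝ) → SigmaAlgebra X
  generatedBy f = record
    { Measurable = Generated f ; resp = resp ; universe = univ
    ; complement = compl ; union = union }

  Borel : ∀ k → SigmaAlgebra (Vector ℝ k)
  Borel k = generatedBy (λ i s → s i)

  Disjoint : {I Ω : Set} → (I → Pred Ω 0ℓ) → Set
  Disjoint A = ∀ {i j ω} → A i ω → A j ω → i ≡ j

  -- A probability measure takes an event together with a proof of its
  -- measurability; by `P-cong` the value does not depend on that proof.

  record ProbabilityMeasure {Ω : Set} (ℱ : SigmaAlgebra Ω) : Set₁ where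
    field
      P          : ∀ {A} → Measurable ℱ A → ℝ
      P-cong     : ∀ {A B} (mA : Measurable ℱ A) (mB : Measurable ℱ B) →
                   A ≐ B → P mA ≡ P mB
      nonneg     : ∀ {A} (mA : Measurable ℱ A) → 0ℝ ≤ P mA
      total      : P (SigmaAlgebra.universe ℱ) ≡ 1ℝ
      σ-additive : {A : ℕ → Pred Ω 0ℓ} (mA : ∀ m → Measurable ℱ (A m)) →
                   Disjoint A →
                   IsSup (λ y → ∃[ N ] y ≡ sum {N} (λ m → P (mA (toℕ m))))
                         (P (SigmaAlgebra.union ℱ mA))

  module _ {Ω : Set} (ℱ : SigmaAlgebra Ω) {k} {f : Ω → Vector ℝ k}
           (mf : ∀ i → MeasurableFunction ℱ (λ ω → f ω i)) where
    private module ℱ = SigmaAlgebra ℱ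

    preimage : ∀ {A} → Measurable (Borel k) A → ℱ.Measurable (A ∘ f)
    preimage (gen i q)            = mf i q
    preimage (resp (A⊆B , B⊆A) b) = ℱ.resp (A⊆B , B⊆A) (preimage b)
    preimage univ                 = ℱ.universe
    preimage (compl b)            = ℱ.complement (preimage b)
    preimage (union b)            = ℱ.union (λ m → preimage (b m))

  Law : ℕ → Set₁
  Law k = ProbabilityMeasure (Borel k)

  AlmostAll : ∀ {k} → Law k → Pred (Vector ℝ k) 0ℓ → Set₁
  AlmostAll {k} μ Q = Σ[ N ∈ Pred (Vector ℝ k) 0ℓ ] Σ[ mN ∈ Measurable (Borel k) N ]
                      ProbabilityMeasure.P μ mN ≡ 0ℝ × (∀ s → ¬ N s → Q s)

  lawOf : ∀ {Ω : Set} {ℱ : SigmaAlgebra Ω} → ProbabilityMeasure ℱ →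
          ∀ {k} {f : Ω → Vector ℝ k} →
          (∀ i → MeasurableFunction ℱ (λ ω → f ω i)) → Law k
  lawOf {ℱ = ℱ} ℙ {f = f} mf = record
    { P          = λ b → P (pre b)
    ; P-cong     = λ { b c (A⊆B , B⊆A) → P-cong (pre b) (pre c) (A⊆B , B⊆A) }
    ; nonneg     = λ b → nonneg (pre b)
    ; total      = total
    ; σ-additive = λ b disj → σ-additive (λ m → pre (b m)) disj
    }
    where
    open ProbabilityMeasure ℙ
    pre : ∀ {A} → Measurable (Borel _) A → Measurable ℱ (A ∘ f)
    pre = preimage ℱ mf

  module _ {Ω : Set} {ℱ : SigmaAlgebra Ω} (ℙ : ProbabilityMeasure ℱ) where
    open ProbabilityMeasure ℙ using (P)

    -- A nonnegative simple function Σᵢ cᵢ 1_{Aᵢ} with 0 ≤ Σᵢ cᵢ 1_{Aᵢ} ≤ X · 1_A;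
    -- the pieces Aᵢ are disjoint subsets of A that need not cover A.

    record SimpleBelow (A : Pred Ω 0ℓ) (X : Ω → ℝ) : Set₁ where
      field
        size        : ℕ
        coefficient : Vector ℝ size
        piece       : Fin size → Pred Ω 0ℓ
        measurable  : ∀ i → Measurable ℱ (piece i)
        nonneg      : ∀ i → 0ℝ ≤ coefficient i
        disjoint    : Disjoint piece
        within      : ∀ i → piece i Pred.⊆ A
        below       : ∀ i {ω} → piece i ω → coefficient i ≤ X ω

      value : ℝ
      value = sum (λ i → coefficient i * P (measurable i))

    -- `IsIntegral A X e`: e is the Lebesgue integral ∫_A X dℙ, for measurable A
    -- and measurable X ≥ 0 (the only case in which it is used).

    IsIntegral : Pred Ω 0ℓ → (Ω → ℝ) → Pred ℝ (lsuc 0ℓ)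
    IsIntegral A X = IsSup (λ y → Σ[ φ ∈ SimpleBelow A X ] y ≡ SimpleBelow.value φ)

    IsExpectation : (Ω → ℝ) → Pred ℝ (lsuc 0ℓ)
    IsExpectation = IsIntegral U

record Graph (n : ℕ) : Set where
  field
    adjacent    : Fin n → Fin n → Bool
    symmetric   : ∀ u v → adjacent u v ≡ adjacent v u
    irreflexive : ∀ v → adjacent v v ≡ false

  Edge : Rel (Fin n) 0ℓ
  Edge u v = T (adjacent u v)

-- A permutation from arrival times to vertices.

ArrivalOrder : ℕ → Set
ArrivalOrder = Permutation′

-- Sequences a₀, …, a_{k-1} with aⱼ : A j.

infixl 5 _▷_

data Prefix {a} (A : ℕ → Set a) : ℕ → Set a where
  []  : Prefix A 0
  _▷_ : ∀ {k} → Prefix A k → A k → Prefix A (suc k)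

-- An online algorithm knows a vertex only by its arrival time, so a subset of
-- the batch of the k-th arrival is a `Subset k`: i stands for the edge between
-- the i-th and the k-th arrival.

Selections : ℕ → Set
Selections = Prefix Subset

data Selected : ∀ {k} → Selections k → ℕ → ℕ → Set where
  here  : ∀ {k} {I : Selections k} {D i} → i ∈ D → Selected (I ▷ D) (toℕ i) k
  there : ∀ {k} {I : Selections k} {D i j} → Selected I i j → Selected (I ▷ D) i j

IsMatching : ∀ {k} → Pred (Selections k) 0ℓ
IsMatching I = ∀ {i j i′ j′} → Selected I i j → Selected I i′ j′ →
               (i ≡ i′ ⊎ i ≡ j′ ⊎ j ≡ i′ ⊎ j ≡ j′) → i ≡ i′ × j ≡ j′

module VertexArrival (R : Reals) where
  open Reals R
  open Probability R
  open SigmaAlgebra using (Measurable; MeasurableFunction)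
  open ProbabilityMeasure using (P)

  -- A vector in [0,1]^B, for a batch B ⊆ {0, …, k-1}, is a vector in ℝᵏ
  -- vanishing outside B.

  Realizations : ℕ → Set
  Realizations = Prefix (Vector ℝ)

  record Arrival (k : ℕ) : Set₁ where
    field
      batch : Subset k
      law   : Law k

  open Arrival

  WithinBatches : ∀ {k} → Prefix Arrival k → Selections k → Set
  WithinBatches []       []      = ⊤
  WithinBatches (as ▷ a) (I ▷ D) = WithinBatches as I × D ⊆ batch a

  FeasibleIn : ∀ {k} → Prefix Arrival k → Selections k → Set
  FeasibleIn as I = WithinBatches as I × IsMatching I

  data Coordinate : ℕ → Set where
    last    : ∀ {k} → Fin k → Coordinate (suc k)
    earlier : ∀ {k} → Coordinate k → Coordinate (suc k)

  coordinate : ∀ {k} → Coordinate k → Realizations k → ℝ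
  coordinate (last i)    (ss ▷ s) = s i
  coordinate (earlier c) (ss ▷ s) = coordinate c ss

  sumSubsets : ∀ k → (Subset k → ℝ) → ℝ
  sumSubsets zero    f = f Vec.[]
  sumSubsets (suc k) f = sumSubsets k (f ∘ (inside Vec.∷_)) + sumSubsets k (f ∘ (outside Vec.∷_))

  sumSelections : ∀ k → (Selections k → ℝ) → ℝ
  sumSelections zero    f = f []
  sumSelections (suc k) f = sumSelections k (λ I → sumSubsets k (λ D → f (I ▷ D)))

  -- Only the revealed data enter `prob`: not n, the graph, or the arrival order.
  -- `prob as ss I D` is the probability, over fresh internal randomness, that
  -- the algorithm selects D at the k-th arrival, given the batches and laws
  -- `as` and realizations `ss` up to and including this arrival and its own
  -- earlier decisions I.

  record OnlineAlgorithm : Set₁ where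
    field
      prob       : ∀ {k} → Prefix Arrival (suc k) → Realizations (suc k) →
                   Selections k → Subset k → ℝ
      nonneg     : ∀ {k} as ss (I : Selections k) D → 0ℝ ≤ prob as ss I D
      total      : ∀ {k} as ss (I : Selections k) → sumSubsets k (prob as ss I) ≡ 1ℝ
      measurable : ∀ {k} as (I : Selections k) D →
                   MeasurableFunction (generatedBy coordinate) (λ ss → prob as ss I D)
      feasible   : ∀ {k} as a ss (I : Selections k) D → FeasibleIn as I →
                   prob (as ▷ a) ss I D ≢ 0ℝ → FeasibleIn (as ▷ a) (I ▷ D)

  module _ {n : ℕ} (G : Graph n) (σ : ArrivalOrder n) where
    open Graph G

    _arrivesBefore_ : Rel (Fin n) 0ℓ
    u arrivesBefore v = (σ ⟨$⟩ˡ u) Fin.< (σ ⟨$⟩ˡ v)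

    InBatch : Rel (Fin n) 0ℓ
    InBatch u v = Edge u v × u arrivesBefore v

    -- `r v ω u` is the coordinate of 𝐫ᵛ at the edge uv, extended by 0 to all
    -- u with uv ∉ B_v.

    record RandomBatches : Set₂ where
      field
        {Ω}         : Set
        {ℱ}         : SigmaAlgebra Ω
        ℙ           : ProbabilityMeasure ℱ
        r           : Fin n → Ω → Vector ℝ n
        measurable  : ∀ v u → MeasurableFunction ℱ (λ ω → r v ω u)
        nonneg      : ∀ v ω u → 0ℝ ≤ r v ω u
        ≤1          : ∀ v ω u → r v ω u ≤ 1ℝ
        off-batch   : ∀ v ω u → ¬ InBatch u v → r v ω u ≡ 0ℝ
        independent : {A : Fin n → Pred (Vector ℝ n) 0ℓ}
                      (mA : ∀ v → Measurable (Borel n) (A v))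
                      (m⋂ : Measurable ℱ (⋂ (Fin n) (λ v → A v ∘ r v))) →
                      P ℙ m⋂ ≡ product (λ v → P ℙ (preimage ℱ (measurable v) (mA v)))

  module _ {n : ℕ} {G : Graph n} {σ : ArrivalOrder n} (𝐫 : RandomBatches G σ) where
    open Graph G
    open RandomBatches 𝐫

    record IsMarginal (x : Fin n → Fin n → ℝ) : Set₁ where
      field
        expectation : ∀ u v → InBatch G σ u v → IsExpectation ℙ (λ ω → r v ω u) (x u v)
        symmetric   : ∀ u v → x u v ≡ x v u
        non-edge    : ∀ u v → ¬ Edge u v → x u v ≡ 0ℝ

    module _ {k : ℕ} (k<n : k ℕ.< n) where

      arriving : Fin n
      arriving = σ ⟨$⟩ʳ fromℕ< k<n

      arrived : Fin k → Fin n
      arrived i = σ ⟨$⟩ʳ inject≤ i (ℕ.<⇒≤ k<n)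

      batchVector : Ω → Vector ℝ k
      batchVector ω i = r arriving ω (arrived i)

      batchLaw : Law k
      batchLaw = lawOf ℙ {f = batchVector} (λ i → measurable arriving (arrived i))

      arrival : Arrival k
      arrival = record
        { batch = Vec.tabulate (λ i → adjacent (arrived i) arriving)
        ; law   = batchLaw }

    arrivals : ∀ {k} → k ℕ.≤ n → Prefix Arrival k
    arrivals {zero}  _   = []
    arrivals {suc k} k<n = arrivals (ℕ.<⇒≤ k<n) ▷ arrival k<n

    realizations : ∀ {k} → k ℕ.≤ n → Ω → Realizations k
    realizations {zero}  _   ω = []
    realizations {suc k} k<n ω = realizations (ℕ.<⇒≤ k<n) ω ▷ batchVector k<n ω

    module _ (alg : OnlineAlgorithm) where
      open OnlineAlgorithm alg using (prob)

      -- Conditional probability of the decision sequence I given 𝐫 = 𝐫(ω).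

      runProb : ∀ {k} → k ℕ.≤ n → Ω → Selections k → ℝ
      runProb _   ω []      = 1ℝ
      runProb k<n ω (I ▷ D) = runProb (ℕ.<⇒≤ k<n) ω I
                            * prob (arrivals k<n) (realizations k<n ω) I D

      -- Conditional probability, given 𝐫 = 𝐫(ω), that the k-th arrival selects
      -- its edge to the i-th.

      selectProb : ∀ {k} → k ℕ.< n → Fin k → Ω → ℝ
      selectProb {k} k<n i ω =
        sumSelections k (λ I → sumSubsets k (λ D →
          if Vec.lookup D i then runProb k<n ω (I ▷ D) else 0ℝ))

      -- g is a version of s ↦ Pr[e ∈ I_v ∣ 𝐫ᵛ = s]: for all Borel A,
      -- Pr[e ∈ I_v, 𝐫ᵛ ∈ A] = ∫_{𝐫ᵛ ∈ A} g(𝐫ᵛ) dℙ.  The left-hand side is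
      -- ∫_{𝐫ᵛ ∈ A} selectProb dℙ.

      record IsConditionalProb {k} (k<n : k ℕ.< n) (i : Fin k) (g : Vector ℝ k → ℝ) : Set₁ where
        field
          measurable-g : MeasurableFunction (Borel k) g
          nonneg-g     : ∀ s → 0ℝ ≤ g s
          version      : ∀ {A} → Measurable (Borel k) A →
                         ∃[ p ] IsIntegral ℙ (A ∘ batchVector k<n) (selectProb k<n i) p
                              × IsIntegral ℙ (A ∘ batchVector k<n) (g ∘ batchVector k<n) p

      Selectable : ℝ → Set₁
      Selectable c =
        ∀ {k} (k<n : k ℕ.< n) (i : Fin k) → Edge (arrived k<n i) (arriving k<n) →
        Σ[ g ∈ (Vector ℝ k → ℝ) ] IsConditionalProb k<n i g
          × AlmostAll (batchLaw k<n) (λ s → c * s i ≤ g s)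

{-# OPTIONS --safe #-}

-- When v arrives with 𝐫ᵛ = s, the algorithm draws at most one u, each with probability s_u, which is
-- possible by (ii), and if u is still free it selects uv with probability ½ / Pr[u is free].
-- Inductively every edge zw is selected with probability ½ x_zw, so at any time
-- Pr[u is free] = 1 − ½ Σ_z x_zu over the arrived z; by (i) this is at least ½ and the selection
-- probability at most 1.  Whether u is free depends on the earlier vectors only, hence it is
-- independent of 𝐫ᵛ, and uv is selected with conditional probability s_u / 2.
--
-- Given 𝐫, the probability F_u that u is free satisfies F_u ↦ F_u (1 − s_u α_u), and
-- F_v = 1 − Σ_u s_u α_u F_u initially.  Independence of products is passed from events to these
-- functions by uniform approximation with simple functions, so no limit theorem is needed.

module Submission where

open import Level using (0ℓ; Lift; lift; lower) renaming (suc to lsuc)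
open import Algebra.Bundles using (CommutativeRing; RawRing)
import Algebra.Properties.AbelianGroup
import Algebra.Properties.CommutativeMonoid.Sum
import Algebra.Properties.Ring
import Algebra.Properties.Semiring.Mult.TCOptimised
import Algebra.Properties.Semiring.Sum
import Algebra.Solver.Ring as RingSolver
open import Algebra.Solver.Ring.AlmostCommutativeRing
  using (_-Raw-AlmostCommutative⟶_; fromCommutativeRing)
open import Axiom.ExcludedMiddle using (ExcludedMiddle)
open import Data.Bool.Base using (Bool; true; false; T; if_then_else_; not; _∧_)
open import Data.Empty using (⊥; ⊥-elim)
open import Data.Fin.Base using (Fin; zero; suc; toℕ; fromℕ; fromℕ<; inject₁; inject≤; punchIn)
open import Data.Fin.Permutation using (_⟨$⟩ʳ_; _⟨$⟩ˡ_; inverseˡ; inverseʳ)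
open import Data.Fin.Properties
  using (_≟_; suc-injective; punchInᵢ≢i; toℕ-fromℕ; toℕ-fromℕ<; toℕ-inject₁; toℕ-inject≤;
         toℕ-injective; toℕ<n)
open import Data.Fin.Relation.Unary.Top using (view; ‵fromℕ; ‵inject₁)
open import Data.Fin.Subset using (Subset; inside; outside; _∈_)
open import Data.List.Base using (List; []; _∷_; _++_)
open import Data.Maybe.Base using (Maybe; just; nothing)
open import Data.Nat.Base using (ℕ; zero; suc)
import Data.Nat.Base as ℕ
import Data.Nat.Properties as ℕ
open import Data.Product.Base using (Σ-syntax; ∃; ∃-syntax; _×_; _,_; proj₁; proj₂)
open import Data.Sum.Base using (_⊎_; inj₁; inj₂; [_,_]′)
open import Data.Unit.Base using (⊤; tt)
open import Data.Vec.Base using (lookup; []; _∷_; here; there)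
open import Data.Vec.Functional using (Vector; head; tail; removeAt)
open import Data.Vec.Properties using ([]=⇒lookup; lookup⇒[]=; lookup∘tabulate)
open import Function.Base using (_∘_)
open import Relation.Binary.Definitions using (tri<; tri≈; tri>)
open import Relation.Binary.PropositionalEquality
  using (_≡_; _≢_; refl; sym; trans; cong; cong₂; subst; subst₂; module ≡-Reasoning)
open import Relation.Binary.Structures using (IsTotalOrder)
open import Relation.Nullary.Decidable using (Dec; yes; no; does; True; toWitness; fromWitness; map′)
open import Relation.Nullary.Negation using (¬_; contradiction)
open import Relation.Unary using (Pred; U; ∁; ∅; ⋃; ⋂; _≐_; _∩_; _∪_; _⊆_)
open import Defs

-- The algorithm is never told x. It recovers the marginals as means of the revealed laws, which is
-- possible because the existence of an expectation can be decided classically; `mean-arrival` ties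
-- these means to x. It must also return a distribution on every input, including inputs that
-- violate (i) or (ii), which explains the truncations and positive parts in its definition. The
-- events that different vertices are free are correlated, yet no joint law of them is needed: as at
-- most one partner is drawn, both recursions are linear in the F_u, with coefficients that depend
-- on the newest vector alone. Independence is given only for product events, one event per vector.
-- Instead of comparing σ-algebras, independence of F_u from later vectors is tested against the
-- indicators of those product events that leave the vectors already seen unconstrained. This
-- property survives linear combinations, and multiplication by a function of a fresh vector turns
-- one unconstrained factor into a constrained one, which is exactly the inductive step.

module RealRing (R : Reals) where
  open Reals R
  open CommutativeRing commutativeRing public
    using (+-assoc; +-comm; +-identityˡ; +-identityʳ; -‿inverseʳ;
           *-assoc; *-comm; *-identityˡ; *-identityʳ; distribˡ; distribʳ; zeroˡ; zeroʳ)
  open CommutativeRing commutativeRing using (ring; semiring)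
  open Algebra.Properties.Ring ring using (-‿distribˡ-*; -‿distribʳ-*; -‿involutive; -0#≈0#)
  open Algebra.Properties.AbelianGroup (CommutativeRing.+-abelianGroup commutativeRing)
    using (⁻¹-∙-comm)
  open Algebra.Properties.Semiring.Mult.TCOptimised semiring using (×-homo-+; ×1-homo-*)
    renaming (_×_ to _⋆_)

  private
    swap : ∀ a b c d → (a + b) + (c + d) ≡ (a + c) + (b + d)
    swap a b c d = begin
      (a + b) + (c + d)  ≡⟨ +-assoc a b (c + d) ⟩
      a + (b + (c + d))  ≡⟨ cong (a +_) (sym (+-assoc b c d)) ⟩
      a + ((b + c) + d)  ≡⟨ cong (λ z → a + (z + d)) (+-comm b c) ⟩
      a + ((c + b) + d)  ≡⟨ cong (a +_) (+-assoc c b d) ⟩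
      a + (c + (b + d))  ≡⟨ sym (+-assoc a c (b + d)) ⟩
      (a + c) + (b + d)  ∎
      where open ≡-Reasoning

    normalise : ℕ × ℕ → ℕ × ℕ
    normalise (a , b) = a ℕ.∸ b , b ℕ.∸ a

    -- Coefficients of the ring solver: (m , n) stands for the integer m − n, with m = 0 or n = 0.
    Coeff : RawRing 0ℓ 0ℓ
    Coeff = record
      { Carrier = ℕ × ℕ
      ; _≈_ = _≡_
      ; _+_ = λ { (a , b) (c , d) → normalise (a ℕ.+ c , b ℕ.+ d) }
      ; _*_ = λ { (a , b) (c , d) → normalise (a ℕ.* c ℕ.+ b ℕ.* d , a ℕ.* d ℕ.+ b ℕ.* c) }
      ; -_ = λ { (a , b) → b , a }
      ; 0# = 0 , 0
      ; 1# = 1 , 0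
      }

    -- The extra clause makes the constants 0 and 1 denote 0ℝ and 1ℝ definitionally.
    ⟦_⟧ᶜ : ℕ × ℕ → ℝ
    ⟦ a , zero ⟧ᶜ      = a ⋆ 1ℝ
    ⟦ a , b@(suc _) ⟧ᶜ = a ⋆ 1ℝ + - (b ⋆ 1ℝ)

    ⟦⟧ᶜ-difference : ∀ a b → ⟦ a , b ⟧ᶜ ≡ a ⋆ 1ℝ + - (b ⋆ 1ℝ)
    ⟦⟧ᶜ-difference a zero    = sym (trans (cong (a ⋆ 1ℝ +_) -0#≈0#) (+-identityʳ _))
    ⟦⟧ᶜ-difference a (suc b) = refl

    cross : ∀ x y z w → x + w ≡ z + y → x + - y ≡ z + - w
    cross x y z w eq = begin
      x + - y                    ≡⟨ sym (+-identityʳ _) ⟩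
      (x + - y) + 0ℝ             ≡⟨ cong ((x + - y) +_) (sym (-‿inverseʳ w)) ⟩
      (x + - y) + (w + - w)      ≡⟨ swap _ _ _ _ ⟩
      (x + w) + (- y + - w)      ≡⟨ cong₂ _+_ eq (+-comm _ _) ⟩
      (z + y) + (- w + - y)      ≡⟨ swap _ _ _ _ ⟩
      (z + - w) + (y + - y)      ≡⟨ cong ((z + - w) +_) (-‿inverseʳ y) ⟩
      (z + - w) + 0ℝ             ≡⟨ +-identityʳ _ ⟩
      z + - w                    ∎
      where open ≡-Reasoning

    ⟦⟧ᶜ-normalise : ∀ p → ⟦ normalise p ⟧ᶜ ≡ ⟦ p ⟧ᶜ
    ⟦⟧ᶜ-normalise (a , b) = trans (⟦⟧ᶜ-difference (a ℕ.∸ b) (b ℕ.∸ a)) (trans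
      (cross _ _ _ _ (trans (sym (×-homo-+ 1ℝ (a ℕ.∸ b) b))
                     (trans (cong (_⋆ 1ℝ) (truncated a b)) (×-homo-+ 1ℝ a (b ℕ.∸ a)))))
      (sym (⟦⟧ᶜ-difference a b)))
      where
      truncated : ∀ a b → a ℕ.∸ b ℕ.+ b ≡ a ℕ.+ (b ℕ.∸ a)
      truncated zero    zero    = refl
      truncated zero    (suc b) = refl
      truncated (suc a) zero    = refl
      truncated (suc a) (suc b) = trans (ℕ.+-suc (a ℕ.∸ b) b) (cong suc (truncated a b))

    minus-product : ∀ a b c d → (a + - b) * (c + - d) ≡ (a * c + b * d) + - (a * d + b * c)
    minus-product a b c d = begin
      (a + - b) * (c + - d)
        ≡⟨ distribʳ (c + - d) a (- b) ⟩
      a * (c + - d) + - b * (c + - d)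
        ≡⟨ cong₂ _+_ (distribˡ a c (- d)) (distribˡ (- b) c (- d)) ⟩
      (a * c + a * - d) + (- b * c + - b * - d)
        ≡⟨ cong₂ _+_ (cong (a * c +_) (sym (-‿distribʳ-* a d)))
                     (cong₂ _+_ (sym (-‿distribˡ-* b c)) bd) ⟩
      (a * c + - (a * d)) + (- (b * c) + b * d)
        ≡⟨ cong ((a * c + - (a * d)) +_) (+-comm _ _) ⟩
      (a * c + - (a * d)) + (b * d + - (b * c))
        ≡⟨ swap _ _ _ _ ⟩
      (a * c + b * d) + (- (a * d) + - (b * c))
        ≡⟨ cong ((a * c + b * d) +_) (⁻¹-∙-comm (a * d) (b * c)) ⟩
      (a * c + b * d) + - (a * d + b * c)  ∎
      where
      open ≡-Reasoning
      bd : - b * - d ≡ b * d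
      bd = trans (sym (-‿distribˡ-* b (- d)))
                 (trans (cong -_ (sym (-‿distribʳ-* b d))) (-‿involutive (b * d)))

    morphism : Coeff -Raw-AlmostCommutative⟶ fromCommutativeRing commutativeRing
    morphism = record
      { ⟦_⟧ = ⟦_⟧ᶜ
      ; +-homo = λ { (a , b) (c , d) →
          trans (trans (⟦⟧ᶜ-normalise (a ℕ.+ c , b ℕ.+ d)) (⟦⟧ᶜ-difference (a ℕ.+ c) (b ℕ.+ d)))
          (trans (cong₂ (λ x y → x + - y) (×-homo-+ 1ℝ a c) (×-homo-+ 1ℝ b d))
          (trans (cong (a ⋆ 1ℝ + c ⋆ 1ℝ +_) (sym (⁻¹-∙-comm _ _)))
          (trans (swap _ _ _ _)
                 (sym (cong₂ _+_ (⟦⟧ᶜ-difference a b) (⟦⟧ᶜ-difference c d)))))) }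
      ; *-homo = λ { (a , b) (c , d) →
          trans (trans (⟦⟧ᶜ-normalise (a ℕ.* c ℕ.+ b ℕ.* d , a ℕ.* d ℕ.+ b ℕ.* c))
            (⟦⟧ᶜ-difference (a ℕ.* c ℕ.+ b ℕ.* d) (a ℕ.* d ℕ.+ b ℕ.* c)))
          (trans (cong₂ (λ x y → x + - y)
                   (trans (×-homo-+ 1ℝ (a ℕ.* c) _) (cong₂ _+_ (×1-homo-* a c) (×1-homo-* b d)))
                   (trans (×-homo-+ 1ℝ (a ℕ.* d) _) (cong₂ _+_ (×1-homo-* a d) (×1-homo-* b c))))
          (trans (sym (minus-product _ _ _ _))
                 (sym (cong₂ _*_ (⟦⟧ᶜ-difference a b) (⟦⟧ᶜ-difference c d))))) }
      ; -‿homo = λ { (a , b) →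
          trans (⟦⟧ᶜ-difference b a)
          (trans (+-comm _ _)
          (trans (cong (- (a ⋆ 1ℝ) +_) (sym (-‿involutive _)))
          (trans (⁻¹-∙-comm _ _) (cong -_ (sym (⟦⟧ᶜ-difference a b)))))) }
      ; 0-homo = refl
      ; 1-homo = refl
      }

    -- Lets the solver detect coefficients that cancel, as in x - x; two differences are compared by
    -- cross addition.
    coeff≟ : ∀ x y → Maybe (⟦ x ⟧ᶜ ≡ ⟦ y ⟧ᶜ)
    coeff≟ (a , b) (c , d) with a ℕ.+ d ℕ.≟ c ℕ.+ b
    ... | no _   = nothing
    ... | yes eq = just (trans (⟦⟧ᶜ-difference a b) (trans (cross _ _ _ _
            (trans (sym (×-homo-+ 1ℝ a d)) (trans (cong (_⋆ 1ℝ) eq) (×-homo-+ 1ℝ c b))))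
            (sym (⟦⟧ᶜ-difference c d))))

  module Solver = RingSolver Coeff (fromCommutativeRing commutativeRing) morphism coeff≟
  open Solver public using (solve; _:=_; _:+_; _:*_; :-_; con)

  :0 :1 : ∀ {n} → Solver.Polynomial n
  :0 = con (0 , 0)
  :1 = con (1 , 0)

-- Classical logic

module Classical (em : ExcludedMiddle (lsuc 0ℓ)) where

  abstract
    dec : (P : Set) → Dec P
    dec P = map′ lower lift (em {Lift (lsuc 0ℓ) P})

  by-contradiction : {P : Set} → ¬ ¬ P → P
  by-contradiction {P} ¬¬p with dec P
  ... | yes p = p
  ... | no ¬p = contradiction ¬p ¬¬p

  -- Excluded middle makes every proposition of the next universe equivalent to a small one.
  Small : Set₁ → Set
  Small P = True (em {P})

-- Order, completeness and rationals in ℝ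

module Analysis (em : ExcludedMiddle (lsuc 0ℓ)) (R : Reals) where
  open Classical em public
  open Reals R
  open RealRing R public

  open IsTotalOrder isTotalOrder public using ()
    renaming (refl to ≤-refl; reflexive to ≤-reflexive; trans to ≤-trans;
              antisym to ≤-antisym; total to ≤-total)

  infix 4 _<_
  -- Encoded as a negation, so that a strict inequality is used by applying it to the opposite weak
  -- one.
  _<_ : ℝ → ℝ → Set
  x < y = ¬ (y ≤ x)

  <⇒≤ : ∀ {x y} → x < y → x ≤ y
  <⇒≤ {x} {y} x<y with ≤-total x y
  ... | inj₁ p = p
  ... | inj₂ p = contradiction p x<y

  infix 4 _≤?_
  _≤?_ : ∀ x y → Dec (x ≤ y)
  x ≤? y = dec (x ≤ y)

  +-mono-≤ : ∀ {a b c d} → a ≤ b → c ≤ d → a + c ≤ b + d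
  +-mono-≤ {a} {b} {c} {d} p q = ≤-trans (+-monoˡ-≤ c p)
    (subst₂ _≤_ (+-comm c b) (+-comm d b) (+-monoˡ-≤ b q))

  +-cancelʳ-≤ : ∀ z {x y} → x + z ≤ y + z → x ≤ y
  +-cancelʳ-≤ z {x} {y} p = subst₂ _≤_ (e x) (e y) (+-monoˡ-≤ (- z) p)
    where
    e : ∀ x → (x + z) + - z ≡ x
    e x = solve 2 (λ x z → (x :+ z) :+ :- z := x) refl x z

  -- x ≤ y because y − x equals b − a.
  lin : ∀ {a b x y} → a ≤ b → x + b ≡ y + a → x ≤ y
  lin {a} {b} {x} {y} p eq = +-cancelʳ-≤ b
    (subst (_≤ y + b) (sym eq) (+-mono-≤ ≤-refl p))

  ≤⇒0≤- : ∀ {x y} → x ≤ y → 0ℝ ≤ y + - x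
  ≤⇒0≤- {x} {y} p = lin p (solve 2 (λ x y → :0 :+ y := (y :+ :- x) :+ x) refl x y)

  +-nonneg : ∀ {x y} → 0ℝ ≤ x → 0ℝ ≤ y → 0ℝ ≤ x + y
  +-nonneg p q = subst (_≤ _) (+-identityʳ 0ℝ) (+-mono-≤ p q)

  *-monoˡ-≤ : ∀ {c x y} → 0ℝ ≤ c → x ≤ y → c * x ≤ c * y
  *-monoˡ-≤ {c} {x} {y} 0≤c p = lin (*-nonneg 0≤c (≤⇒0≤- p))
    (solve 3 (λ c x y → c :* x :+ c :* (y :+ :- x) := c :* y :+ :0) refl c x y)

  *-monoʳ-≤ : ∀ {c x y} → 0ℝ ≤ c → x ≤ y → x * c ≤ y * c
  *-monoʳ-≤ {c} {x} {y} 0≤c p = subst₂ _≤_ (*-comm c x) (*-comm c y) (*-monoˡ-≤ 0≤c p)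

  0≤1 : 0ℝ ≤ 1ℝ
  0≤1 with ≤-total 0ℝ 1ℝ
  ... | inj₁ p = p
  ... | inj₂ p = subst (0ℝ ≤_) (solve 0 ((:0 :+ :- :1) :* (:0 :+ :- :1) := :1) refl)
                   (*-nonneg (≤⇒0≤- p) (≤⇒0≤- p))

  0<1 : 0ℝ < 1ℝ
  0<1 1≤0 = 0≢1 (≤-antisym 0≤1 1≤0)

  ≤+nonneg : ∀ {x y} → 0ℝ ≤ y → x ≤ x + y
  ≤+nonneg {x} {y} p = lin p (solve 2 (λ x y → x :+ y := (x :+ y) :+ :0) refl x y)

  *≤ˡ : ∀ {x y} → 0ℝ ≤ y → x ≤ 1ℝ → x * y ≤ y
  *≤ˡ {x} {y} p q = subst (x * y ≤_) (*-identityˡ y) (*-monoʳ-≤ p q)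

  *≤1 : ∀ {x y} → 0ℝ ≤ y → x ≤ 1ℝ → y ≤ 1ℝ → x * y ≤ 1ℝ
  *≤1 p q r = ≤-trans (*≤ˡ p q) r

  1-≤1 : ∀ {x} → 0ℝ ≤ x → 1ℝ + - x ≤ 1ℝ
  1-≤1 {x} p = lin p (solve 1 (λ x → (:1 :+ :- x) :+ x := :1 :+ :0) refl x)

  <-≤-trans : ∀ {x y z} → x < y → y ≤ z → x < z
  <-≤-trans x<y y≤z z≤x = x<y (≤-trans y≤z z≤x)

  ≤-<-trans : ∀ {x y z} → x ≤ y → y < z → x < z
  ≤-<-trans x≤y y<z z≤x = y<z (≤-trans z≤x x≤y)

  <⇒0<- : ∀ {x y} → x < y → 0ℝ < y + - x
  <⇒0<- {x} {y} x<y p = x<y (lin p (solve 2 (λ x y → y :+ :0 := x :+ (y :+ :- x)) refl x y))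

  record PositiveInverse (x : ℝ) : Set where
    field
      inv     : ℝ
      x*inv≡1 : x * inv ≡ 1ℝ
      0≤inv   : 0ℝ ≤ inv

  abstract
    positiveInverse : ∀ {x} → 0ℝ < x → PositiveInverse x
    positiveInverse {x} 0<x with inverse x (λ x≡0 → 0<x (≤-reflexive x≡0))
    ... | y , xy≡1 = record { inv = y ; x*inv≡1 = xy≡1 ; 0≤inv = by-contradiction absurd }
      where
      absurd : ¬ ¬ (0ℝ ≤ y)
      absurd ¬0≤y = 0<1 (subst (_≤ 0ℝ) xy≡1 (lin (*-nonneg (<⇒≤ 0<x) (≤⇒0≤- (<⇒≤ ¬0≤y)))
        (solve 2 (λ x y → x :* y :+ x :* (:0 :+ :- y) := :0 :+ :0) refl x y)))

  *-pos : ∀ {x y} → 0ℝ < x → 0ℝ < y → 0ℝ < x * y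
  *-pos {x} {y} 0<x 0<y xy≤0 = 0<y (lin (*-monoˡ-≤ 0≤inv xy≤0)
    (trans (solve 3 (λ x y i → y :+ i :* :0 := :1 :* y) refl x y inv)
      (trans (cong (_* y) (sym x*inv≡1))
             (solve 3 (λ x y i → (x :* i) :* y := :0 :+ i :* (x :* y)) refl x y inv))))
    where open PositiveInverse (positiveInverse 0<x)

  ½+½≡1 : ½ + ½ ≡ 1ℝ
  ½+½≡1 = trans (solve 1 (λ h → h :+ h := (:1 :+ :1) :* h) refl ½)
                (proj₂ (inverse (1ℝ + 1ℝ) 2≢0))

  0≤½ : 0ℝ ≤ ½
  0≤½ with ≤-total 0ℝ ½
  ... | inj₁ p = p
  ... | inj₂ p = contradiction (subst₂ _≤_ ½+½≡1 (+-identityʳ 0ℝ) (+-mono-≤ p p)) 0<1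

  0<½ : 0ℝ < ½
  0<½ p = 0<1 (subst₂ _≤_ ½+½≡1 (+-identityʳ 0ℝ) (+-mono-≤ p p))

  ½*2 : ∀ x → ½ * x + ½ * x ≡ x
  ½*2 x = trans (solve 2 (λ h x → h :* x :+ h :* x := (h :+ h) :* x) refl ½ x)
                (trans (cong (_* x) ½+½≡1) (*-identityˡ x))

  ≤-by-ε : ∀ {a b} → (∀ {ε} → 0ℝ < ε → a ≤ b + ε) → a ≤ b
  ≤-by-ε {a} {b} h = by-contradiction λ b<a →
    -- With half the gap as ε, the hypothesis gives a - b ≤ ½ (a - b), which is absurd for a
    -- positive gap.
    let δ   = a + - b
        0<δ = *-pos 0<½ (<⇒0<- b<a)
    in 0<δ (lin (h 0<δ) (trans (solve 3 (λ a b e → e :+ (b :+ e) := (e :+ e) :+ b) refl a b (½ * δ))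
         (trans (cong (_+ b) (½*2 δ)) (solve 2 (λ a b → (a :+ :- b) :+ b := :0 :+ a) refl a b))))

  abstract
    -- δ = ε / (1 + K); the summand 1 keeps the denominator positive when K = 0.
    small : ∀ {K ε} → 0ℝ ≤ K → 0ℝ < ε → ∃[ δ ] 0ℝ < δ × K * δ ≤ ε
    small {K} {ε} 0≤K 0<ε = ε * inv , *-pos 0<ε 0<inv ,
      lin (*-nonneg (<⇒≤ 0<ε) 0≤inv)
        (trans (solve 3 (λ K e i → K :* (e :* i) :+ e :* i := e :* ((:1 :+ K) :* i)) refl K ε inv)
          (trans (cong (ε *_) x*inv≡1) (solve 1 (λ e → e :* :1 := e :+ :0) refl ε)))
      where
      open PositiveInverse (positiveInverse (<-≤-trans 0<1 (≤+nonneg 0≤K)))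
      0<inv : 0ℝ < inv
      0<inv inv≤0 = 0<1 (subst₂ _≤_ x*inv≡1 (zeroʳ _)
        (*-monoˡ-≤ (≤-trans 0≤1 (≤+nonneg 0≤K)) inv≤0))

  infixr 8 _·_
  _·_ : ℕ → ℝ → ℝ
  zero  · x = 0ℝ
  suc n · x = x + n · x

  ·-*-assoc : ∀ n x y → (n · x) * y ≡ n · (x * y)
  ·-*-assoc zero    x y = zeroˡ y
  ·-*-assoc (suc n) x y = trans (distribʳ y x (n · x)) (cong (x * y +_) (·-*-assoc n x y))

  ·-nonneg : ∀ n {x} → 0ℝ ≤ x → 0ℝ ≤ n · x
  ·-nonneg zero    p = ≤-refl
  ·-nonneg (suc n) p = +-nonneg p (·-nonneg n p)

  abstract
    -- Otherwise the multiples of 1 are bounded and have a supremum s; since the successor of a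
    -- multiple is again one, s - 1 is still an upper bound.
    archimedean : ∀ x → ∃[ n ] x ≤ n · 1ℝ
    archimedean x = by-contradiction λ ¬∃ →
      let S         = λ y → ∃[ n ] y ≡ n · 1ℝ
          s , ub , lub = complete S (0ℝ , zero , refl)
                           (x , λ { (n , refl) → <⇒≤ (λ p → ¬∃ (n , p)) })
          s-1-ub : UpperBound _≤_ S (s + - 1ℝ)
          s-1-ub = λ { (n , refl) → lin (ub (suc n , refl))
            (solve 2 (λ m s → m :+ s := (s :+ :- :1) :+ (:1 :+ m)) refl (n · 1ℝ) s) }
      in 0<1 (lin (lub s-1-ub) (solve 1 (λ s → :1 :+ (s :+ :- :1) := :0 :+ s) refl s))

  module _ (m : ℕ) where
    private M = suc m · 1ℝ

    0≤suc·1 : 0ℝ ≤ M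
    0≤suc·1 = ·-nonneg (suc m) 0≤1

    open PositiveInverse (positiveInverse {M} (<-≤-trans 0<1 (≤+nonneg (·-nonneg m 0≤1)))) public
      renaming (inv to 1/suc; x*inv≡1 to suc*1/suc≡1; 0≤inv to 0≤1/suc)

    suc·1/suc≡1 : suc m · 1/suc ≡ 1ℝ
    suc·1/suc≡1 = trans (cong (suc m ·_) (sym (*-identityˡ 1/suc)))
                        (trans (sym (·-*-assoc (suc m) 1ℝ 1/suc)) suc*1/suc≡1)

  1/suc-small : ∀ {ε} → 0ℝ < ε → ∃[ m ] 1/suc m ≤ ε
  1/suc-small {ε} 0<ε = m , invert (suc*1/suc≡1 m) (0≤1/suc m)
    (subst (_≤ M * ε) (trans (*-comm inv ε) x*inv≡1) (*-monoʳ-≤ (<⇒≤ 0<ε) inv≤M))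
    where
    open PositiveInverse (positiveInverse 0<ε)
    m = proj₁ (archimedean inv)
    M = suc m · 1ℝ
    inv≤M : inv ≤ M
    inv≤M = ≤-trans (proj₂ (archimedean inv))
      (subst (_≤ M) (+-identityˡ _) (+-monoˡ-≤ (m · 1ℝ) 0≤1))
    invert : ∀ {u M} → M * u ≡ 1ℝ → 0ℝ ≤ u → 1ℝ ≤ M * ε → u ≤ ε
    invert {u} {M} Mu≡1 0≤u 1≤Mε = subst₂ _≤_ (*-identityʳ u)
      (trans (solve 3 (λ u M e → u :* (M :* e) := (M :* u) :* e) refl u M ε)
             (trans (cong (_* ε) Mu≡1) (*-identityˡ ε)))
      (*-monoˡ-≤ 0≤u 1≤Mε)

  floor : ∀ {x} → 0ℝ ≤ x → ∃[ n ] n · 1ℝ ≤ x × x < suc n · 1ℝ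
  floor {x} 0≤x = go (proj₁ (archimedean x)) (proj₂ (archimedean x))
    where
    go : ∀ m → x ≤ m · 1ℝ → ∃[ n ] n · 1ℝ ≤ x × x < suc n · 1ℝ
    go zero    x≤0 = zero , 0≤x , λ 1≤x → 0<1 (≤-trans (subst (_≤ x) (+-identityʳ 1ℝ) 1≤x) x≤0)
    go (suc m) x≤sm with m · 1ℝ ≤? x
    ... | no m≰x  = go m (<⇒≤ m≰x)
    ... | yes m≤x with suc m · 1ℝ ≤? x
    ...   | no sm≰x  = m , m≤x , sm≰x
    -- Here x equals `suc m`, which is then its own floor.
    ...   | yes sm≤x = suc m , sm≤x , λ p → 0<1 (lin (≤-trans p x≤sm)
              (solve 1 (λ m → :1 :+ m := :0 :+ (:1 :+ m)) refl (suc m · 1ℝ)))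

  private
    -- The number a / (m + 1) - b. Every rational has this form, and three natural indices suit
    -- countable unions.
    rational′ : ℕ → ℕ → ℕ → ℝ
    rational′ m a b = (a · 1ℝ) * 1/suc m + - (b · 1ℝ)

    -- The shift b makes x + b nonnegative, and 1 / (m + 1) is at most half the gap. The first
    -- multiple of 1 / (m + 1) strictly above x + b, shifted back, lies between x and y.
    rationals-dense′ : ∀ {x y} → x < y → ∃[ m ] ∃[ a ] ∃[ b ] x < rational′ m a b × rational′ m a b < y
    rationals-dense′ {x} {y} x<y = m , suc n , b , x<t , t<y
      where
      δ = ½ * (y + - x)
      0<δ = *-pos 0<½ (<⇒0<- x<y)
      b = proj₁ (archimedean (- x))
      B = b · 1ℝ
      0≤x+B : 0ℝ ≤ x + B
      0≤x+B = lin (proj₂ (archimedean (- x)))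
        (solve 2 (λ x B → :0 :+ B := (x :+ B) :+ :- x) refl x B)
      m = proj₁ (1/suc-small 0<δ)
      u = 1/suc m
      M = suc m · 1ℝ
      Mfloor = floor (*-nonneg (0≤suc·1 m) 0≤x+B)
      n = proj₁ Mfloor
      N = n · 1ℝ
      cancel : ∀ z → M * (z * u) ≡ z
      cancel z = trans (solve 3 (λ M z u → M :* (z :* u) := z :* (M :* u)) refl M z u)
                       (trans (cong (z *_) (suc*1/suc≡1 m)) (*-identityʳ z))
      x<t : x < rational′ m (suc n) b
      x<t t≤x = proj₂ (proj₂ Mfloor) (subst (_≤ M * (x + B)) (cancel (1ℝ + N))
        (*-monoˡ-≤ (0≤suc·1 m) (lin t≤x
          (solve 3 (λ s x B → s :+ x := (x :+ B) :+ (s :+ :- B)) refl ((1ℝ + N) * u) x B))))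
      Nu≤x+B : N * u ≤ x + B
      Nu≤x+B = subst (N * u ≤_)
        (trans (solve 3 (λ M z u → (M :* z) :* u := M :* (z :* u)) refl M (x + B) u) (cancel (x + B)))
        (*-monoʳ-≤ (0≤1/suc m) (proj₁ (proj₂ Mfloor)))
      t<y : rational′ m (suc n) b < y
      t<y y≤t = 0<δ (lin (≤-trans y≤t (lin (+-mono-≤ Nu≤x+B (proj₂ (1/suc-small 0<δ)))
          (solve 5 (λ N u B x d → ((:1 :+ N) :* u :+ :- B) :+ ((x :+ B) :+ d)
                                 := (x :+ d) :+ (N :* u :+ u)) refl N u B x δ)))
        (trans (solve 2 (λ x d → d :+ (x :+ d) := (d :+ d) :+ x) refl x δ)
          (trans (cong (_+ x) (½*2 _)) (solve 2 (λ x y → (y :+ :- x) :+ x := :0 :+ y) refl x y))))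

  -- Abstract, so that the ring solver does not unfold the reciprocal inside a rational.
  abstract
    rational : ℕ → ℕ → ℕ → ℝ
    rational = rational′

    rationals-dense : ∀ {x y} → x < y → ∃[ m ] ∃[ a ] ∃[ b ] x < rational m a b × rational m a b < y
    rationals-dense = rationals-dense′

  infixl 7 _⊓_
  _⊓_ : ℝ → ℝ → ℝ
  x ⊓ y = if does (x ≤? y) then x else y

  ⊓-≤ˡ : ∀ x y → x ⊓ y ≤ x
  ⊓-≤ˡ x y with x ≤? y
  ... | yes _  = ≤-refl
  ... | no y<x = <⇒≤ y<x

  ⊓-≤ʳ : ∀ x y → x ⊓ y ≤ y
  ⊓-≤ʳ x y with x ≤? y
  ... | yes x≤y = x≤y
  ... | no _    = ≤-refl

  ⊓-≤-inv : ∀ x y {q} → x ⊓ y ≤ q → x ≤ q ⊎ y ≤ q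
  ⊓-≤-inv x y p with x ≤? y
  ... | yes _ = inj₁ p
  ... | no _  = inj₂ p

  ⊓-nonneg : ∀ {x y} → 0ℝ ≤ x → 0ℝ ≤ y → 0ℝ ≤ x ⊓ y
  ⊓-nonneg {x} {y} p q with x ≤? y
  ... | yes _ = p
  ... | no _  = q

  ⊓-≥ : ∀ {x y} → y ≤ x → x ⊓ y ≡ y
  ⊓-≥ {x} {y} y≤x with x ≤? y
  ... | yes x≤y = ≤-antisym x≤y y≤x
  ... | no _    = refl

  infix 9 _⁺
  _⁺ : ℝ → ℝ
  x ⁺ = if does (0ℝ ≤? x) then x else 0ℝ

  ⁺-nonneg : ∀ x → 0ℝ ≤ x ⁺
  ⁺-nonneg x with 0ℝ ≤? x
  ... | yes p = p
  ... | no _  = ≤-refl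

  ≤⁺ : ∀ x → x ≤ x ⁺
  ≤⁺ x with 0ℝ ≤? x
  ... | yes _  = ≤-refl
  ... | no x<0 = <⇒≤ x<0

  ⁺-lub : ∀ {x y} → 0ℝ ≤ y → x ≤ y → x ⁺ ≤ y
  ⁺-lub {x} p q with 0ℝ ≤? x
  ... | yes _ = q
  ... | no _  = p

  ⁺-id : ∀ {x} → 0ℝ ≤ x → x ⁺ ≡ x
  ⁺-id {x} p = ≤-antisym (⁺-lub p ≤-refl) (≤⁺ x)

-- Closure properties of measurable sets and functions

module MeasurableSets (em : ExcludedMiddle (lsuc 0ℓ)) (R : Reals)
                      {Ω : Set} (ℱ : Probability.SigmaAlgebra R Ω) where
  open Analysis em R
  open Reals R
  open Probability R using (module SigmaAlgebra)
  open SigmaAlgebra ℱ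

  ∅-measurable : Measurable ∅
  ∅-measurable = resp ((λ ¬u → ¬u tt) , λ ()) (complement universe)

  ∪-measurable : ∀ {A B} → Measurable A → Measurable B → Measurable (A ∪ B)
  ∪-measurable {A} {B} mA mB = resp (to , from) (union {A = A∪B} mA∪B)
    where
    A∪B : ℕ → Pred Ω 0ℓ
    A∪B zero    = A
    A∪B (suc _) = B
    mA∪B : ∀ m → Measurable (A∪B m)
    mA∪B zero    = mA
    mA∪B (suc _) = mB
    to : ⋃ ℕ A∪B ⊆ A ∪ B
    to (zero  , a) = inj₁ a
    to (suc _ , b) = inj₂ b
    from : A ∪ B ⊆ ⋃ ℕ A∪B
    from (inj₁ a) = zero , a
    from (inj₂ b) = suc zero , b

  ∩-measurable : ∀ {A B} → Measurable A → Measurable B → Measurable (A ∩ B)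
  ∩-measurable mA mB = resp
    ( (λ n → by-contradiction (n ∘ inj₁) , by-contradiction (n ∘ inj₂))
    , (λ { (a , b) (inj₁ ¬a) → ¬a a ; (a , b) (inj₂ ¬b) → ¬b b }) )
    (complement (∪-measurable (complement mA) (complement mB)))

  ⋂-measurable : ∀ {n} {A : Fin n → Pred Ω 0ℓ} → (∀ i → Measurable (A i)) → Measurable (⋂ (Fin n) A)
  ⋂-measurable {zero}      mA = resp ((λ _ ()) , _) universe
  ⋂-measurable {suc n} {A} mA = resp (to , λ a → a zero , a ∘ suc)
    (∩-measurable (mA zero) (⋂-measurable (mA ∘ suc)))
    where
    to : A zero ∩ ⋂ (Fin n) (A ∘ suc) ⊆ ⋂ (Fin (suc n)) A
    to (a₀ , a) zero    = a₀
    to (a₀ , a) (suc i) = a i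

  module _ {X : Ω → ℝ} (mX : MeasurableFunction X) where

    >-measurable : ∀ q → Measurable (λ ω → q < X ω)
    >-measurable q = complement (mX q)

  -- X + Y > q holds exactly when some rational t satisfies X > t and Y > q - t, which is a
  -- countable union.
  +-measurable : ∀ {X Y} → MeasurableFunction X → MeasurableFunction Y →
                 MeasurableFunction (λ ω → X ω + Y ω)
  +-measurable {X} {Y} mX mY q = resp
    ( (λ n → by-contradiction λ q<X+Y → n (split q<X+Y))
    , λ { X+Y≤q (m , a , b , t<X , q-t<Y) → t<X (lin (+-mono-≤ (<⇒≤ q-t<Y) X+Y≤q)
          (solve 4 (λ X Y q t → X :+ (Y :+ q) := t :+ ((q :+ :- t) :+ (X :+ Y))) refl
                 _ _ q (rational m a b))) } )
    (complement (union λ m → union λ a → union λ b →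
      ∩-measurable (>-measurable mX (rational m a b)) (>-measurable mY (q + - rational m a b))))
    where
    split : ∀ {ω} → q < X ω + Y ω →
      ∃[ m ] ∃[ a ] ∃[ b ] rational m a b < X ω × q + - rational m a b < Y ω
    split {ω} q<X+Y with rationals-dense {q + - Y ω} {X ω} (λ p → q<X+Y (lin p
      (solve 3 (λ q X Y → (X :+ Y) :+ (q :+ :- Y) := q :+ X) refl q (X ω) (Y ω))))
    ... | m , a , b , q-Y<t , t<X = m , a , b , t<X , λ p → q-Y<t (lin p
      (solve 3 (λ q t Y → t :+ (q :+ :- t) := (q :+ :- Y) :+ Y) refl q (rational m a b) (Y ω)))

  -- Measurability is stated through the sets X ≤ q; the strict version is the union of X ≤ t over
  -- the rationals t < q.
  <-measurable : ∀ {X} → MeasurableFunction X → ∀ q → Measurable (λ ω → X ω < q)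
  <-measurable {X} mX q = resp
    ( (λ (m , a , b , X≤t , t<q) → ≤-<-trans X≤t t<q)
    , (λ X<q → let m , a , b , X<t , t<q = rationals-dense X<q in m , a , b , <⇒≤ X<t , t<q) )
    (union λ m → union λ a → union λ b → below (rational m a b))
    where
    below : ∀ t → Measurable (λ ω → X ω ≤ t × t < q)
    below t with dec (t < q)
    ... | yes t<q = resp ((_, t<q) , proj₁) (mX t)
    ... | no t≮q  = resp ((λ ()) , λ (_ , t<q) → contradiction t<q t≮q) ∅-measurable

  neg-measurable : ∀ {X} → MeasurableFunction X → MeasurableFunction (λ ω → - X ω)
  neg-measurable {X} mX q = resp
    ( (λ {ω} ≮ → lin (by-contradiction {( - q) ≤ X ω} ≮)
        (solve 2 (λ q x → :- x :+ x := q :+ :- q) refl q (X ω)))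
    , (λ {ω} -X≤q X<-q → X<-q (lin -X≤q (solve 2 (λ q x → :- q :+ q := x :+ :- x) refl q (X ω)))) )
    (complement (<-measurable mX (- q)))

  const-measurable : ∀ c → MeasurableFunction (λ _ → c)
  const-measurable c q with c ≤? q
  ... | yes c≤q = resp ((λ _ → c≤q) , _) universe
  ... | no c≰q  = resp ((λ ()) , c≰q) ∅-measurable

  ⊓-measurable : ∀ {X Y} → MeasurableFunction X → MeasurableFunction Y →
                 MeasurableFunction (λ ω → X ω ⊓ Y ω)
  ⊓-measurable mX mY q = resp
    ([ ≤-trans (⊓-≤ˡ _ _) , ≤-trans (⊓-≤ʳ _ _) ]′ , ⊓-≤-inv _ _) (∪-measurable (mX q) (mY q))

  ⁺-measurable : ∀ {X} → MeasurableFunction X → MeasurableFunction (λ ω → X ω ⁺)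
  ⁺-measurable {X} mX q with 0ℝ ≤? q
  ... | yes 0≤q = resp ((λ X≤q → ⁺-lub 0≤q X≤q) , ≤-trans (≤⁺ _)) (mX q)
  ... | no 0≰q  = resp ((λ ()) , λ X⁺≤q → 0≰q (≤-trans (⁺-nonneg _) X⁺≤q)) ∅-measurable

  *-measurable : ∀ {X c} → 0ℝ ≤ c → MeasurableFunction X → MeasurableFunction (λ ω → X ω * c)
  *-measurable {X} {c} 0≤c mX q with dec (c ≤ 0ℝ)
  ... | yes c≤0 = resp ((λ {ω} 0≤q → subst (_≤ q) (sym (X*c≡0 ω)) 0≤q) , λ {ω} p → subst (_≤ q) (X*c≡0 ω) p)
                    (const-measurable 0ℝ q)
    where
    X*c≡0 : ∀ ω → X ω * c ≡ 0ℝ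
    X*c≡0 ω = trans (cong (X ω *_) (≤-antisym c≤0 0≤c)) (zeroʳ (X ω))
  ... | no 0<c  = resp
      ( (λ {ω} X≤qi → subst (X ω * c ≤_) (undo q) (*-monoʳ-≤ 0≤c X≤qi))
      , (λ {ω} Xc≤q → subst (_≤ q * inv) (trans (*-assoc _ _ _) (trans (cong (X ω *_) x*inv≡1) (*-identityʳ _)))
                        (*-monoʳ-≤ 0≤inv Xc≤q)) )
      (mX (q * inv))
    where
    open PositiveInverse (positiveInverse 0<c)
    undo : ∀ q → q * inv * c ≡ q
    undo q = trans (solve 3 (λ q i c → q :* i :* c := q :* (c :* i)) refl q inv c)
                   (trans (cong (q *_) x*inv≡1) (*-identityʳ q))

-- Simple functions as formal sums of indicators

module SimpleFunctions (em : ExcludedMiddle (lsuc 0ℓ)) (R : Reals)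
                       {Ω : Set} (ℱ : Probability.SigmaAlgebra R Ω) where
  open Analysis em R
  open Reals R
  open Probability R using (module SigmaAlgebra)
  open SigmaAlgebra ℱ

  𝟙 : Pred Ω 0ℓ → Ω → ℝ
  𝟙 A ω = if does (dec (A ω)) then 1ℝ else 0ℝ

  𝟙-∈ : ∀ {A ω} → A ω → 𝟙 A ω ≡ 1ℝ
  𝟙-∈ {A} {ω} a with dec (A ω)
  ... | yes _ = refl
  ... | no ¬a = contradiction a ¬a

  𝟙-∉ : ∀ {A ω} → ¬ A ω → 𝟙 A ω ≡ 0ℝ
  𝟙-∉ {A} {ω} ¬a with dec (A ω)
  ... | yes a = contradiction a ¬a
  ... | no _  = refl

  𝟙-nonneg : ∀ A ω → 0ℝ ≤ 𝟙 A ω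
  𝟙-nonneg A ω with dec (A ω)
  ... | yes _ = 0≤1
  ... | no _  = ≤-refl

  𝟙-≤1 : ∀ A ω → 𝟙 A ω ≤ 1ℝ
  𝟙-≤1 A ω with dec (A ω)
  ... | yes _ = ≤-refl
  ... | no _  = 0≤1

  𝟙-cong : ∀ {A B} → A ≐ B → ∀ ω → 𝟙 A ω ≡ 𝟙 B ω
  𝟙-cong {A} {B} (A⊆B , B⊆A) ω with dec (A ω)
  ... | yes a = sym (𝟙-∈ {B} (A⊆B a))
  ... | no ¬a = sym (𝟙-∉ {B} (¬a ∘ B⊆A))

  𝟙-∩ : ∀ A B ω → 𝟙 (A ∩ B) ω ≡ 𝟙 A ω * 𝟙 B ω
  𝟙-∩ A B ω with dec (A ω)
  ... | no ¬a = trans (𝟙-∉ {A ∩ B} (¬a ∘ proj₁)) (sym (zeroˡ _))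
  ... | yes a = trans (𝟙-cong′ (dec (B ω))) (sym (*-identityˡ _))
    where
    𝟙-cong′ : Dec (B ω) → 𝟙 (A ∩ B) ω ≡ 𝟙 B ω
    𝟙-cong′ (yes b) = trans (𝟙-∈ {A ∩ B} (a , b)) (sym (𝟙-∈ {B} b))
    𝟙-cong′ (no ¬b) = trans (𝟙-∉ {A ∩ B} (¬b ∘ proj₂)) (sym (𝟙-∉ {B} ¬b))

  record Term : Set₁ where
    constructor term
    field
      coef       : ℝ
      {set}      : Pred Ω 0ℓ
      measurable : Measurable set

  -- Σ cᵢ 1_{Aᵢ}, with arbitrary signs and possibly overlapping Aᵢ.
  Simple : Set₁
  Simple = List Term

  eval : Simple → Ω → ℝ
  eval []                      ω = 0ℝ
  eval (term c {A} mA ∷ φ) ω = c * 𝟙 A ω + eval φ ω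

  scale : ℝ → Simple → Simple
  scale a []              = []
  scale a (term c mA ∷ φ) = term (a * c) mA ∷ scale a φ

  eval-++ : ∀ φ ψ ω → eval (φ ++ ψ) ω ≡ eval φ ω + eval ψ ω
  eval-++ []                  ψ ω = sym (+-identityˡ _)
  eval-++ (term c {A} mA ∷ φ) ψ ω =
    trans (cong (c * 𝟙 A ω +_) (eval-++ φ ψ ω)) (sym (+-assoc _ _ _))

  eval-scale : ∀ a φ ω → eval (scale a φ) ω ≡ a * eval φ ω
  eval-scale a []                  ω = sym (zeroʳ a)
  eval-scale a (term c {A} mA ∷ φ) ω = trans (cong ((a * c) * 𝟙 A ω +_) (eval-scale a φ ω))
    (solve 4 (λ a c x y → (a :* c) :* x :+ a :* y := a :* (c :* x :+ y)) refl a c (𝟙 A ω) (eval φ ω))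

-- Finite additivity and integrals of simple functions

module Measure (em : ExcludedMiddle (lsuc 0ℓ)) (R : Reals)
               {Ω : Set} {ℱ : Probability.SigmaAlgebra R Ω}
               (ℙ : Probability.ProbabilityMeasure R ℱ) where
  open Analysis em R
  open Reals R
  open Probability R using (module SigmaAlgebra; module ProbabilityMeasure; Disjoint)
  open SigmaAlgebra ℱ
  open ProbabilityMeasure ℙ
  open MeasurableSets em R ℱ
  open SimpleFunctions em R ℱ

  -- Copies of an empty set are disjoint, so the partial sum of two terms in σ-additivity gives p +
  -- p ≤ p.
  P-∅ : ∀ {A} (mA : Measurable A) → (∀ ω → ¬ A ω) → P mA ≡ 0ℝ
  P-∅ {A} mA ¬a = ≤-antisym (lin p+p≤p (solve 1 (λ p → p :+ p := :0 :+ (p :+ (p :+ :0))) refl (P mA)))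
                            (nonneg mA)
    where
    p+p≤p : P mA + (P mA + 0ℝ) ≤ P mA
    p+p≤p = subst (P mA + (P mA + 0ℝ) ≤_)
      (P-cong (union (λ _ → mA)) mA ((λ (_ , a) → a) , λ a → zero , a))
      (proj₁ (σ-additive (λ _ → mA) (λ a → contradiction a (¬a _))) (2 , refl))

  -- Padding A, B with empty sets makes the partial sums constant from the second on, so their
  -- supremum is that sum.
  P-∪ : ∀ {A B C} (mA : Measurable A) (mB : Measurable B) (mC : Measurable C) →
        C ≐ A ∪ B → (∀ ω → A ω → ¬ B ω) → P mC ≡ P mA + P mB
  P-∪ {A} {B} {C} mA mB mC (C⊆ , ⊆C) disj = trans (P-cong mC (union mS) (to , from))
    (≤-antisym
      (proj₂ sup λ { (N , refl) → partial N })
      (subst (_≤ P (union mS)) (cong (P mA +_) (+-identityʳ _)) (proj₁ sup (2 , refl))))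
    where
    S : ℕ → Pred Ω 0ℓ
    S 0 = A
    S 1 = B
    S (suc (suc _)) = ∅
    mS : ∀ m → Measurable (S m)
    mS 0 = mA
    mS 1 = mB
    mS (suc (suc _)) = ∅-measurable
    to : C ⊆ ⋃ ℕ S
    to c with C⊆ c
    ... | inj₁ a = 0 , a
    ... | inj₂ b = 1 , b
    from : ⋃ ℕ S ⊆ C
    from (0 , a) = ⊆C (inj₁ a)
    from (1 , b) = ⊆C (inj₂ b)
    S-disjoint : Disjoint S
    S-disjoint {0} {0} a b = refl
    S-disjoint {0} {1} a b = contradiction b (disj _ a)
    S-disjoint {1} {0} b a = contradiction b (disj _ a)
    S-disjoint {1} {1} a b = refl
    sup = σ-additive mS S-disjoint
    zeros : ∀ N → sum {N} (λ _ → P ∅-measurable) ≡ 0ℝ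
    zeros zero    = refl
    zeros (suc N) = trans (cong₂ _+_ (P-∅ ∅-measurable λ _ ()) (zeros N)) (+-identityʳ 0ℝ)
    partial : ∀ N → sum {N} (λ m → P (mS (toℕ m))) ≤ P mA + P mB
    partial zero          = +-nonneg (nonneg mA) (nonneg mB)
    partial (suc zero)    = +-mono-≤ ≤-refl (nonneg mB)
    partial (suc (suc N)) = ≤-reflexive (cong (P mA +_)
      (trans (cong (P mB +_) (zeros N)) (+-identityʳ _)))

  P-split : ∀ {A B} (mA : Measurable A) (mB : Measurable B) →
            P mA ≡ P (∩-measurable mA mB) + P (∩-measurable mA (complement mB))
  P-split {A} {B} mA mB = P-∪ _ _ mA (to , λ { (inj₁ (a , _)) → a ; (inj₂ (a , _)) → a })
                              (λ ω (_ , b) (_ , ¬b) → ¬b b)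
    where
    to : A ⊆ (A ∩ B) ∪ (A ∩ ∁ B)
    to {ω} a with dec (B ω)
    ... | yes b = inj₁ (a , b)
    ... | no ¬b = inj₂ (a , ¬b)

  P-mono : ∀ {A B} (mA : Measurable A) (mB : Measurable B) → A ⊆ B → P mA ≤ P mB
  P-mono mA mB A⊆B = subst₂ _≤_ (P-cong _ mA (proj₂ , λ a → A⊆B a , a)) (sym (P-split mB mA))
    (≤+nonneg (nonneg _))

  P≤1 : ∀ {A} (mA : Measurable A) → P mA ≤ 1ℝ
  P≤1 mA = subst (P mA ≤_) total (P-mono mA universe _)

  -- The integral of φ over B. Localising to B lets an induction along φ cut B by one set at a time,
  -- so overlapping sets need no common refinement.
  valOn : ∀ {B} → Measurable B → Simple → ℝ
  valOn mB []              = 0ℝ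
  valOn mB (term c mA ∷ φ) = c * P (∩-measurable mB mA) + valOn mB φ

  val : Simple → ℝ
  val []              = 0ℝ
  val (term c mA ∷ φ) = c * P mA + val φ

  val-++ : ∀ φ ψ → val (φ ++ ψ) ≡ val φ + val ψ
  val-++ []              ψ = sym (+-identityˡ _)
  val-++ (term c mA ∷ φ) ψ = trans (cong (c * P mA +_) (val-++ φ ψ)) (sym (+-assoc _ _ _))

  val-scale : ∀ a φ → val (scale a φ) ≡ a * val φ
  val-scale a []              = sym (zeroʳ a)
  val-scale a (term c mA ∷ φ) = trans (cong ((a * c) * P mA +_) (val-scale a φ))
    (solve 4 (λ a c x y → (a :* c) :* x :+ a :* y := a :* (c :* x :+ y)) refl a c (P mA) (val φ))

  valOn-universe : ∀ φ → valOn universe φ ≡ val φ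
  valOn-universe []              = refl
  valOn-universe (term c mA ∷ φ) = cong₂ (λ p v → c * p + v)
    (P-cong _ mA (proj₂ , λ a → _ , a)) (valOn-universe φ)

  valOn-split : ∀ {A B} (mB : Measurable B) (mA : Measurable A) φ →
    valOn mB φ ≡ valOn (∩-measurable mB mA) φ + valOn (∩-measurable mB (complement mA)) φ
  valOn-split mB mA []              = sym (+-identityʳ 0ℝ)
  valOn-split mB mA (term c mC ∷ φ) = trans
    (cong₂ (λ p v → c * p + v)
      (trans (P-split (∩-measurable mB mC) mA)
        (cong₂ _+_
          (P-cong _ (∩-measurable (∩-measurable mB mA) mC)
            ((λ ((b , c) , a) → (b , a) , c) , λ ((b , a) , c) → (b , c) , a))
          (P-cong _ (∩-measurable (∩-measurable mB (complement mA)) mC)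
            ((λ ((b , c) , a) → (b , a) , c) , λ ((b , a) , c) → (b , c) , a))))
      (valOn-split mB mA φ))
    (solve 5 (λ c p q v w → c :* (p :+ q) :+ (v :+ w) := (c :* p :+ v) :+ (c :* q :+ w)) refl
      c _ _ (valOn (∩-measurable mB mA) φ) (valOn (∩-measurable mB (complement mA)) φ))

-- Closeness of real numbers

module Nearness (em : ExcludedMiddle (lsuc 0ℓ)) (R : Reals) where
  open Analysis em R
  open Reals R

  Near : ℝ → ℝ → ℝ → Set
  Near ε a b = a ≤ b + ε × b ≤ a + ε

  near-refl : ∀ {ε a} → 0ℝ ≤ ε → Near ε a a
  near-refl 0≤ε = ≤+nonneg 0≤ε , ≤+nonneg 0≤ε

  near-mono : ∀ {δ ε a b} → δ ≤ ε → Near δ a b → Near ε a b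
  near-mono δ≤ε (p , q) = ≤-trans p (+-mono-≤ ≤-refl δ≤ε) , ≤-trans q (+-mono-≤ ≤-refl δ≤ε)

  near-+ : ∀ {δ ε a b c d} → Near δ a b → Near ε c d → Near (δ + ε) (a + c) (b + d)
  near-+ (p , q) (r , s) = shuffle p r , shuffle q s
    where
    shuffle : ∀ {x y z w u v} → x ≤ y + u → z ≤ w + v → x + z ≤ y + w + (u + v)
    shuffle {x} {y} {z} {w} {u} {v} p q = subst (x + z ≤_)
      (solve 4 (λ y u w v → (y :+ u) :+ (w :+ v) := (y :+ w) :+ (u :+ v)) refl y u w v)
      (+-mono-≤ p q)

  near-trans : ∀ {δ ε a b c} → Near δ a b → Near ε b c → Near (δ + ε) a c
  near-trans (p , q) (r , s) = chain p r , subst (_ ≤_) (cong (_ +_) (+-comm _ _)) (chain s q)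
    where
    chain : ∀ {x y z u v} → x ≤ y + u → y ≤ z + v → x ≤ z + (u + v)
    chain {x} {y} {z} {u} {v} p q = ≤-trans p (lin q
      (solve 4 (λ y z u v → (y :+ u) :+ (z :+ v) := (z :+ (u :+ v)) :+ y) refl y z u v))

  near-*-nonneg : ∀ {ε a b} c → 0ℝ ≤ c → Near ε a b → Near (c * ε) (c * a) (c * b)
  near-*-nonneg {ε} {a} {b} c 0≤c (p , q) =
    subst (c * a ≤_) (distribˡ c b ε) (*-monoˡ-≤ 0≤c p) ,
    subst (c * b ≤_) (distribˡ c a ε) (*-monoˡ-≤ 0≤c q)

  near-*-≤1 : ∀ {ε a b} c → 0ℝ ≤ ε → 0ℝ ≤ c → c ≤ 1ℝ → Near ε a b → Near ε (c * a) (c * b)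
  near-*-≤1 c 0≤ε 0≤c c≤1 n = near-mono (*≤ˡ 0≤ε c≤1) (near-*-nonneg c 0≤c n)

  near-neg : ∀ {ε a b} → Near ε a b → Near ε (- a) (- b)
  near-neg {ε} {a} {b} (p , q) =
    lin q (solve 3 (λ e a b → :- a :+ (a :+ e) := (:- b :+ e) :+ b) refl ε a b) ,
    lin p (solve 3 (λ e a b → :- b :+ (b :+ e) := (:- a :+ e) :+ a) refl ε a b)

  -- K is the absolute value of c; for negative c both sides are negated first.
  near-* : ∀ c → ∃[ K ] 0ℝ ≤ K × (∀ {ε a b} → Near ε a b → Near (K * ε) (c * a) (c * b))
  near-* c with ≤-total 0ℝ c
  ... | inj₁ 0≤c = c , 0≤c , near-*-nonneg c 0≤c
  ... | inj₂ c≤0 = - c , subst (0ℝ ≤_) (+-identityˡ (- c)) (≤⇒0≤- c≤0) , λ {ε} {a} {b} n →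
    subst₂ (Near (- c * ε)) (solve 2 (λ c a → :- c :* :- a := c :* a) refl c a)
                            (solve 2 (λ c a → :- c :* :- a := c :* a) refl c b)
      (near-*-nonneg (- c) (subst (0ℝ ≤_) (+-identityˡ (- c)) (≤⇒0≤- c≤0)) (near-neg n))

-- Monotonicity of simple integrals and disjoint simple functions

module Integration (em : ExcludedMiddle (lsuc 0ℓ)) (R : Reals)
                   {Ω : Set} {ℱ : Probability.SigmaAlgebra R Ω}
                   (ℙ : Probability.ProbabilityMeasure R ℱ) where
  open Analysis em R
  open Nearness em R
  open Reals R
  open Probability R using (module SigmaAlgebra; module ProbabilityMeasure; SimpleBelow; Disjoint)
  open SigmaAlgebra ℱ
  open ProbabilityMeasure ℙ
  open MeasurableSets em R ℱ
  open SimpleFunctions em R ℱ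
  open Measure em R ℙ

  private
    -- The integral of c + φ over B; the constant c collects the coefficients of terms already
    -- processed.
    shifted : ∀ {B} → ℝ → Measurable B → Simple → ℝ
    shifted c mB φ = c * P mB + valOn mB φ

    shifted-split : ∀ {A B} c d (mB : Measurable B) (mA : Measurable A) φ →
      shifted c mB (term d mA ∷ φ) ≡
      shifted (c + d) (∩-measurable mB mA) φ + shifted c (∩-measurable mB (complement mA)) φ
    shifted-split c d mB mA φ = trans
      (cong₂ (λ p v → c * p + (d * P (∩-measurable mB mA) + v)) (P-split mB mA) (valOn-split mB mA φ))
      (solve 6 (λ c d p q v w → c :* (p :+ q) :+ (d :* p :+ (v :+ w))
                             := ((c :+ d) :* p :+ v) :+ (c :* q :+ w)) refl
        c d (P (∩-measurable mB mA)) (P (∩-measurable mB (complement mA)))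
        (valOn (∩-measurable mB mA) φ) (valOn (∩-measurable mB (complement mA)) φ))

    eval-∈ : ∀ c d {A} (mA : Measurable A) φ {ω} → A ω →
             c + eval (term d mA ∷ φ) ω ≡ (c + d) + eval φ ω
    eval-∈ c d {A} mA φ {ω} a = trans (cong (λ z → c + (d * z + eval φ ω)) (𝟙-∈ {A} a))
      (solve 3 (λ c d e → c :+ (d :* :1 :+ e) := (c :+ d) :+ e) refl c d (eval φ ω))

    eval-∉ : ∀ c d {A} (mA : Measurable A) φ {ω} → ¬ A ω →
             c + eval (term d mA ∷ φ) ω ≡ c + eval φ ω
    eval-∉ c d {A} mA φ {ω} ¬a = trans (cong (λ z → c + (d * z + eval φ ω)) (𝟙-∉ {A} ¬a))
      (solve 3 (λ c d e → c :+ (d :* :0 :+ e) := c :+ e) refl c d (eval φ ω))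

    -- Cutting B by the set of the first term moves its coefficient into the constant on one half
    -- and drops it on the other. When no term is left, a point of B fixes the sign of c, and an
    -- empty B has measure 0.
    shifted-nonneg : ∀ φ c {B} (mB : Measurable B) →
      (∀ ω → B ω → 0ℝ ≤ c + eval φ ω) → 0ℝ ≤ shifted c mB φ
    shifted-nonneg [] c {B} mB h with dec (∃ B)
    ... | yes (ω , b) = +-nonneg (*-nonneg (subst (0ℝ ≤_) (+-identityʳ c) (h ω b)) (nonneg mB)) ≤-refl
    ... | no ¬∃ = ≤-reflexive (sym (trans (+-identityʳ _)
                    (trans (cong (c *_) (P-∅ mB λ ω b → ¬∃ (ω , b))) (zeroʳ c))))
    shifted-nonneg (term d mA ∷ φ) c mB h = subst (0ℝ ≤_) (sym (shifted-split c d mB mA φ))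
      (+-nonneg
        (shifted-nonneg φ (c + d) _ λ ω (b , a) → subst (0ℝ ≤_) (eval-∈ c d mA φ a) (h ω b))
        (shifted-nonneg φ c _ λ ω (b , ¬a) → subst (0ℝ ≤_) (eval-∉ c d mA φ ¬a) (h ω b)))

  -- Apply `shifted-nonneg` to ε + ψ - φ. With ε = 0 in both directions, `val` depends on the
  -- function only, not on its representation.
  val-mono : ∀ φ ψ ε → (∀ ω → eval φ ω ≤ eval ψ ω + ε) → val φ ≤ val ψ + ε
  val-mono φ ψ ε h = lin 0≤shifted (trans
    (cong (val φ +_) (cong₂ (λ p v → ε * p + v) total
      (trans (valOn-universe (scale (- 1ℝ) φ ++ ψ)) (trans (val-++ (scale (- 1ℝ) φ) ψ) (cong (_+ val ψ) (val-scale (- 1ℝ) φ))))))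
    (solve 3 (λ a b e → a :+ (e :* :1 :+ (:- :1 :* a :+ b)) := (b :+ e) :+ :0) refl (val φ) (val ψ) ε))
    where
    0≤shifted : 0ℝ ≤ shifted ε universe (scale (- 1ℝ) φ ++ ψ)
    0≤shifted = shifted-nonneg (scale (- 1ℝ) φ ++ ψ) ε universe λ ω _ → subst (0ℝ ≤_)
      (trans (solve 3 (λ a b e → (b :+ e) :+ :- a := e :+ (:- :1 :* a :+ b)) refl (eval φ ω) (eval ψ ω) ε)
        (cong (ε +_) (sym (trans (eval-++ (scale (- 1ℝ) φ) ψ ω) (cong (_+ eval ψ ω) (eval-scale (- 1ℝ) φ ω))))))
      (≤⇒0≤- (h ω))

  module _ {A : Pred Ω 0ℓ} {X : Ω → ℝ} where
    open SimpleBelow hiding (nonneg)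

    zeroBelow : SimpleBelow ℙ A X
    zeroBelow = record
      { size = 0 ; coefficient = λ () ; piece = λ () ; measurable = λ () ; nonneg = λ ()
      ; disjoint = λ { {()} } ; within = λ () ; below = λ () }

    consBelow : ∀ c {B} → Measurable B → 0ℝ ≤ c → B ⊆ A → (∀ {ω} → B ω → c ≤ X ω) →
                (ψ : SimpleBelow ℙ A X) → (∀ i {ω} → piece ψ i ω → ¬ B ω) → SimpleBelow ℙ A X
    consBelow c {B} mB 0≤c B⊆A c≤X ψ disj = record
      { size        = suc (size ψ)
      ; coefficient = λ { zero → c ; (suc i) → coefficient ψ i }
      ; piece       = pieces
      ; measurable  = λ { zero → mB ; (suc i) → measurable ψ i }
      ; nonneg      = λ { zero → 0≤c ; (suc i) → SimpleBelow.nonneg ψ i }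
      ; disjoint    = pieces-disjoint
      ; within      = λ { zero → B⊆A ; (suc i) → within ψ i }
      ; below       = λ { zero → c≤X ; (suc i) → below ψ i }
      }
      where
      pieces : Fin (suc (size ψ)) → Pred Ω 0ℓ
      pieces zero    = B
      pieces (suc i) = piece ψ i
      pieces-disjoint : Disjoint pieces
      pieces-disjoint {zero}  {zero}  _ _ = refl
      pieces-disjoint {zero}  {suc j} b p = contradiction b (disj j p)
      pieces-disjoint {suc i} {zero}  p b = contradiction b (disj i p)
      pieces-disjoint {suc i} {suc j} p q = cong suc (disjoint ψ p q)

    -- Cutting B along the sets of φ turns (c + φ)⁺ on B into a disjoint simple function, added to ψ.
    positivePart : ∀ φ c {B} (mB : Measurable B) (ψ : SimpleBelow ℙ A X) →
      (∀ {ω} → B ω → 0ℝ < c + eval φ ω → A ω × c + eval φ ω ≤ X ω) →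
      (∀ i {ω} → piece ψ i ω → ¬ B ω) →
      Σ[ χ ∈ SimpleBelow ℙ A X ] value ψ + shifted c mB φ ≤ value χ
        × (∀ i {ω} → piece χ i ω → B ω ⊎ ∃[ j ] piece ψ j ω)
    positivePart [] c {B} mB ψ h disj with c ≤? 0ℝ
    -- The piece B is left out, as its contribution c P(B) is at most 0.
    ... | yes c≤0 = ψ ,
        lin (*-monoʳ-≤ (nonneg mB) c≤0)
          (solve 3 (λ v c p → (v :+ (c :* p :+ :0)) :+ :0 :* p := v :+ c :* p) refl (value ψ) c (P mB)) ,
        λ i p → inj₂ (i , p)
    ... | no 0<c = consBelow c mB (<⇒≤ 0<c) (λ b → proj₁ (h b 0<c+0))
          (λ b → subst (_≤ X _) (+-identityʳ c) (proj₂ (h b 0<c+0))) ψ disj ,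
        ≤-reflexive (trans (+-comm _ _) (cong (_+ value ψ) (+-identityʳ _))) ,
        λ { zero b → inj₁ b ; (suc i) p → inj₂ (i , p) }
      where
      0<c+0 : 0ℝ < c + 0ℝ
      0<c+0 = 0<c ∘ subst (_≤ 0ℝ) (+-identityʳ c)
    positivePart (term d mA ∷ φ) c {B} mB ψ h disj
      with positivePart φ (c + d) (∩-measurable mB mA) ψ
             (λ (b , a) → subst (λ z → 0ℝ < z → _ × z ≤ _) (eval-∈ c d mA φ a) (h b))
             (λ i p (b , _) → disj i p b)
    -- The last component locates the pieces of χ, which keeps them disjoint from the second half of
    -- B.
    ... | χ , ψ≤χ , inχ
      with positivePart φ c (∩-measurable mB (complement mA)) χ
             (λ (b , ¬a) → subst (λ z → 0ℝ < z → _ × z ≤ _) (eval-∉ c d mA φ ¬a) (h b))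
             (λ i p (b , ¬a) → [ (λ (_ , a) → ¬a a) , (λ (j , q) → disj j q b) ]′ (inχ i p))
    ... | ξ , χ≤ξ , inξ = ξ ,
        ≤-trans (lin ψ≤χ (trans (cong (λ z → value ψ + z + value χ) (shifted-split c d mB mA φ))
          (solve 4 (λ v s t w → (v :+ (s :+ t)) :+ w := (w :+ t) :+ (v :+ s)) refl (value ψ) _ _ (value χ)))) χ≤ξ ,
        λ i p → [ inj₁ ∘ proj₁ , (λ (j , q) → [ inj₁ ∘ proj₁ , inj₂ ]′ (inχ j q)) ]′ (inξ i p)

    -- The positive part of φ - ε: subtracting ε brings φ below X, and where φ ≤ ε nothing is
    -- demanded, in particular outside A.
    simpleBelow : ∀ φ ε → (∀ ω → ε < eval φ ω → A ω × eval φ ω ≤ X ω + ε) →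
                  Σ[ χ ∈ SimpleBelow ℙ A X ] val φ ≤ value χ + ε
    simpleBelow φ ε h = χ , lin (proj₁ (proj₂ below-φ))
      (trans (solve 3 (λ v w e → v :+ w := (w :+ e) :+ (:0 :+ (:- e :* :1 :+ v))) refl (val φ) (value χ) ε)
        (cong (λ z → (value χ + ε) + (0ℝ + z)) (cong₂ (λ p v → - ε * p + v)
          (sym total) (sym (valOn-universe φ)))))
      where
      h′ : ∀ {ω} → ⊤ → 0ℝ < - ε + eval φ ω → A ω × - ε + eval φ ω ≤ X ω
      h′ {ω} _ pos = let a , φ≤X+ε = h ω (λ φ≤ε → pos (lin φ≤ε
                           (solve 2 (λ e v → (:- e :+ v) :+ e := :0 :+ v) refl ε (eval φ ω)))) in
        a , lin φ≤X+ε (solve 3 (λ e v x → (:- e :+ v) :+ (x :+ e) := x :+ v) refl ε (eval φ ω) (X ω))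
      below-φ = positivePart φ (- ε) universe zeroBelow h′ (λ ())
      χ = proj₁ below-φ

-- Lebesgue integrals through uniform approximation

module Integrals (em : ExcludedMiddle (lsuc 0ℓ)) (R : Reals)
                 {Ω : Set} {ℱ : Probability.SigmaAlgebra R Ω}
                 (ℙ : Probability.ProbabilityMeasure R ℱ) where
  open Analysis em R
  open Nearness em R
  open Reals R
  open Probability R
    using (module SigmaAlgebra; module ProbabilityMeasure; SimpleBelow; IsIntegral; Disjoint)
  open SigmaAlgebra ℱ
  open ProbabilityMeasure ℙ
  open SimpleFunctions em R ℱ
  open Measure em R ℙ
  open Integration em R ℙ

  fromVector : ∀ {m} → Vector ℝ m → {A : Fin m → Pred Ω 0ℓ} → (∀ i → Measurable (A i)) → Simple
  fromVector {zero}  c mA = []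
  fromVector {suc m} c mA = term (c zero) (mA zero) ∷ fromVector (c ∘ suc) (mA ∘ suc)

  val-fromVector : ∀ {m} (c : Vector ℝ m) {A : Fin m → Pred Ω 0ℓ} (mA : ∀ i → Measurable (A i)) →
    val (fromVector c mA) ≡ sum (λ i → c i * P (mA i))
  val-fromVector {zero}  c mA = refl
  val-fromVector {suc m} c mA = cong (c zero * P (mA zero) +_) (val-fromVector (c ∘ suc) (mA ∘ suc))

  eval-fromVector-∉ : ∀ {m} (c : Vector ℝ m) {A : Fin m → Pred Ω 0ℓ} (mA : ∀ i → Measurable (A i)) {ω} →
    (∀ i → ¬ A i ω) → eval (fromVector c mA) ω ≡ 0ℝ
  eval-fromVector-∉ {zero}  c     mA ¬a = refl
  eval-fromVector-∉ {suc m} c {A} mA ¬a = trans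
    (cong₂ (λ p v → c zero * p + v) (𝟙-∉ {A zero} (¬a zero)) (eval-fromVector-∉ (c ∘ suc) (mA ∘ suc) (¬a ∘ suc)))
    (trans (+-identityʳ _) (zeroʳ _))

  -- Disjointness leaves at most one nonzero term at ω; 0 ≤ y covers the points in no piece.
  eval-fromVector-≤ : ∀ {m} (c : Vector ℝ m) {A : Fin m → Pred Ω 0ℓ} (mA : ∀ i → Measurable (A i)) {ω y} →
    Disjoint A → 0ℝ ≤ y → (∀ i → A i ω → c i ≤ y) → eval (fromVector c mA) ω ≤ y
  eval-fromVector-≤ {zero}  c     mA         disj 0≤y c≤y = 0≤y
  eval-fromVector-≤ {suc m} c {A} mA {ω} {y} disj 0≤y c≤y with dec (A zero ω)
  ... | yes a = subst (_≤ y) (sym (trans (cong (c zero * 1ℝ +_)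
                  (eval-fromVector-∉ (c ∘ suc) (mA ∘ suc) λ i a′ → contradiction (disj a a′) λ ()))
                  (trans (+-identityʳ _) (*-identityʳ _)))) (c≤y zero a)
  ... | no ¬a = subst (_≤ y) (sym (trans (cong (_+ eval (fromVector (c ∘ suc) (mA ∘ suc)) ω) (zeroʳ (c zero)))
                  (+-identityˡ _)))
                  (eval-fromVector-≤ (c ∘ suc) (mA ∘ suc) (λ p q → suc-injective (disj p q)) 0≤y (c≤y ∘ suc))

  module _ {A : Pred Ω 0ℓ} {X : Ω → ℝ} (0≤X : ∀ ω → 0ℝ ≤ X ω) where

    value≤val : (ψ : SimpleBelow ℙ A X) → ∀ φ ε → (∀ ω → X ω * 𝟙 A ω ≤ eval φ ω + ε) →
                SimpleBelow.value ψ ≤ val φ + ε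
    value≤val ψ φ ε h = subst (_≤ val φ + ε) (val-fromVector coefficient measurable)
      (val-mono (fromVector coefficient measurable) φ ε λ ω → ≤-trans
        (eval-fromVector-≤ coefficient measurable disjoint (*-nonneg (0≤X ω) (𝟙-nonneg A ω)) λ i a →
          subst (coefficient i ≤_) (sym (trans (cong (X ω *_) (𝟙-∈ {A} (within i a))) (*-identityʳ _)))
            (below i a))
        (h ω))
      where open SimpleBelow ψ

    private
      below-near : ∀ φ ε → (∀ ω → Near ε (X ω * 𝟙 A ω) (eval φ ω)) →
                   Σ[ χ ∈ SimpleBelow ℙ A X ] val φ ≤ SimpleBelow.value χ + ε
      below-near φ ε near = simpleBelow φ ε below
        where
        below : ∀ ω → ε < eval φ ω → A ω × eval φ ω ≤ X ω + ε
        below ω ε<φ with dec (A ω)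
                       | proj₂ (near ω)
        ... | yes a | q = a , subst (λ z → eval φ ω ≤ z + ε) (*-identityʳ _) q
        ... | no ¬a | q = contradiction
          (subst (eval φ ω ≤_) (trans (cong (_+ ε) (zeroʳ _)) (+-identityˡ ε)) q) ε<φ

    -- Every simple function below X has value at most `val φ` + ε, and `simpleBelow` exhibits one
    -- that comes within ε of `val φ`.
    integral-near : ∀ {p} → IsIntegral ℙ A X p → ∀ φ ε → (∀ ω → Near ε (X ω * 𝟙 A ω) (eval φ ω)) →
                    Near ε p (val φ)
    integral-near (ub , lub) φ ε near =
      lub (λ { (ψ , refl) → value≤val ψ φ ε (proj₁ ∘ near) }) ,
      ≤-trans (proj₂ (below-near φ ε near)) (+-monoˡ-≤ ε (ub (proj₁ (below-near φ ε near) , refl)))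

    -- Converse of `integral-near`: it leads from uniform approximation back to the supremum in the
    -- definition of the integral.
    isIntegral : ∀ {e} → (∀ {ε} → 0ℝ < ε → Σ[ φ ∈ Simple ]
                   (∀ ω → Near ε (X ω * 𝟙 A ω) (eval φ ω)) × Near ε e (val φ)) →
                 IsIntegral ℙ A X e
    isIntegral {e} h =
      (λ { (ψ , refl) → ≤-by-ε λ {ε} 0<ε →
        let δ , 0<δ , 2δ≤ε = small (+-nonneg 0≤1 0≤1) 0<ε
            φ , near , (_ , φ≤e) = h 0<δ
        in ≤-trans (value≤val ψ φ δ (proj₁ ∘ near)) (two 2δ≤ε φ≤e) }) ,
      λ {b} ub → ≤-by-ε λ {ε} 0<ε →
        let δ , 0<δ , 2δ≤ε = small (+-nonneg 0≤1 0≤1) 0<ε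
            φ , near , (e≤φ , _) = h 0<δ
            χ , φ≤χ = below-near φ δ near
        in ≤-trans e≤φ (two 2δ≤ε (≤-trans φ≤χ (+-monoˡ-≤ δ (ub (χ , refl)))))
      where
      two : ∀ {δ ε x y} → (1ℝ + 1ℝ) * δ ≤ ε → x ≤ y + δ → x + δ ≤ y + ε
      two {δ} {ε} {x} {y} 2δ≤ε x≤y+δ = lin (+-mono-≤ 2δ≤ε x≤y+δ)
        (solve 4 (λ d e x y → (x :+ d) :+ (e :+ (y :+ d)) := (y :+ e) :+ ((:1 :+ :1) :* d :+ x)) refl δ ε x y)

    -- Completeness takes predicates in `Set`, whereas the values of simple functions form a
    -- predicate one universe up; `Small` lowers it.
    integral-exists : (∀ ω → X ω ≤ 1ℝ) → ∃ (IsIntegral ℙ A X)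
    integral-exists X≤1 = s , (λ q → ub (fromWitness q)) , λ h → lub (h ∘ toWitness)
      where
      S : Pred ℝ 0ℓ
      S y = Small (Σ[ φ ∈ SimpleBelow ℙ A X ] y ≡ SimpleBelow.value φ)
      bounded : UpperBound _≤_ S 1ℝ
      bounded s with toWitness s
      ... | ψ , refl = subst (SimpleBelow.value ψ ≤_)
        (trans (+-identityʳ _) (trans (+-identityʳ _) (trans (*-identityˡ _) total)))
        (value≤val ψ (term 1ℝ universe ∷ []) 0ℝ λ ω → subst (X ω * 𝟙 A ω ≤_)
          (sym (trans (+-identityʳ _) (trans (+-identityʳ _) (trans (*-identityˡ _) (𝟙-∈ {U} {ω} _)))))
          (*≤1 (𝟙-nonneg A ω) (X≤1 ω) (𝟙-≤1 A ω)))
      supremum = complete S (0ℝ , fromWitness (zeroBelow , refl)) (1ℝ , bounded)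
      s   = proj₁ supremum
      ub  = proj₁ (proj₂ supremum)
      lub = proj₂ (proj₂ supremum)

  integral-unique : ∀ {A X p q} → IsIntegral ℙ A X p → IsIntegral ℙ A X q → p ≡ q
  integral-unique (ub , lub) (ub′ , lub′) = ≤-antisym (lub ub′) (lub′ ub)

  -- e is the integral of the bounded, possibly negative, function f.
  Int : (Ω → ℝ) → ℝ → Set₁
  Int f e = ∀ {ε} → 0ℝ < ε → Σ[ φ ∈ Simple ] (∀ ω → Near ε (f ω) (eval φ ω)) × Near ε e (val φ)

  Int-cong : ∀ {f g e e′} → (∀ ω → f ω ≡ g ω) → e ≡ e′ → Int f e → Int g e′
  Int-cong f≗g e≡e′ I 0<ε with I 0<ε
  ... | φ , n , m = φ , (λ ω → subst (λ z → Near _ z _) (f≗g ω) (n ω)) , subst (λ z → Near _ z _) e≡e′ m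

  Int-simple : ∀ φ → Int (eval φ) (val φ)
  Int-simple φ 0<ε = φ , (λ ω → near-refl (<⇒≤ 0<ε)) , near-refl (<⇒≤ 0<ε)

  Int-𝟙 : ∀ {A} (mA : Measurable A) → Int (𝟙 A) (P mA)
  Int-𝟙 {A} mA = Int-cong (λ ω → trans (+-identityʳ _) (*-identityˡ _)) (trans (+-identityʳ _) (*-identityˡ _))
    (Int-simple (term 1ℝ mA ∷ []))

  Int-0 : Int (λ _ → 0ℝ) 0ℝ
  Int-0 = Int-simple []

  private
    halve : ∀ {δ ε} → (1ℝ + 1ℝ) * δ ≤ ε → δ + δ ≤ ε
    halve {δ} = subst (_≤ _) (solve 1 (λ d → (:1 :+ :1) :* d := d :+ d) refl δ)

  Int-+ : ∀ {f g d e} → Int f d → Int g e → Int (λ ω → f ω + g ω) (d + e)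
  Int-+ {f} {g} {d} {e} I J {ε} 0<ε with small (+-nonneg 0≤1 0≤1) 0<ε
  ... | δ , 0<δ , 2δ≤ε with I 0<δ | J 0<δ
  ... | φ , n , m | ψ , n′ , m′ = φ ++ ψ ,
    (λ ω → subst (Near ε (f ω + g ω)) (sym (eval-++ φ ψ ω)) (near-mono (halve 2δ≤ε) (near-+ (n ω) (n′ ω)))) ,
    subst (Near ε (d + e)) (sym (val-++ φ ψ)) (near-mono (halve 2δ≤ε) (near-+ m m′))

  Int-* : ∀ c {f e} → Int f e → Int (λ ω → c * f ω) (c * e)
  Int-* c {f} {e} I {ε} 0<ε with near-* c
  ... | K , 0≤K , scaled with small 0≤K 0<ε
  ... | δ , 0<δ , Kδ≤ε with I 0<δ
  ... | φ , n , m = scale c φ ,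
    (λ ω → subst (Near ε (c * f ω)) (sym (eval-scale c φ ω)) (near-mono Kδ≤ε (scaled (n ω)))) ,
    subst (Near ε (c * e)) (sym (val-scale c φ)) (near-mono Kδ≤ε (scaled m))

  -- Two approximations in a row, of f by g and of g by a simple function, each within δ where 2δ ≤
  -- ε.
  Int-limit : ∀ {f e} → (∀ {ε} → 0ℝ < ε → Σ[ g ∈ (Ω → ℝ) ] Σ[ d ∈ ℝ ]
                (∀ ω → Near ε (f ω) (g ω)) × Near ε e d × Int g d) → Int f e
  Int-limit h {ε} 0<ε with small (+-nonneg 0≤1 0≤1) 0<ε
  ... | δ , 0<δ , 2δ≤ε with h 0<δ
  ... | g , d , n , m , I with I 0<δ
  ... | φ , n′ , m′ = φ , (λ ω → near-mono (halve 2δ≤ε) (near-trans (n ω) (n′ ω))) ,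
    near-mono (halve 2δ≤ε) (near-trans m m′)

-- Layer-cake approximation

module Layers (em : ExcludedMiddle (lsuc 0ℓ)) (R : Reals)
              {Ω : Set} (ℱ : Probability.SigmaAlgebra R Ω) where
  open Analysis em R
  open Nearness em R
  open Reals R
  open Probability R using (module SigmaAlgebra)
  open SigmaAlgebra ℱ
  open MeasurableSets em R ℱ
  open SimpleFunctions em R ℱ

  module _ {A : Pred Ω 0ℓ} (mA : Measurable A) {X : Ω → ℝ} (mX : MeasurableFunction X)
           {δ : ℝ} (0≤δ : 0ℝ ≤ δ) where

    -- The layer-cake approximation from below, on A, of X − a by n levels of height δ.
    layers : ℝ → ℕ → Simple
    layers a zero    = []
    layers a (suc n) = term δ (∩-measurable mA (>-measurable mX (a + δ))) ∷ layers (a + δ) n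

    private
      head-∉ : ∀ a n {ω} → ¬ (A ω × a + δ < X ω) → eval (layers a (suc n)) ω ≡ eval (layers (a + δ) n) ω
      head-∉ a n {ω} ∉ = trans (cong (λ z → δ * z + eval (layers (a + δ) n) ω)
                                 (𝟙-∉ {A ∩ (λ ω → a + δ < X ω)} ∉))
        (trans (cong (_+ eval (layers (a + δ) n) ω) (zeroʳ δ)) (+-identityˡ _))

      head-∈ : ∀ a n {ω} → A ω → a + δ < X ω →
               eval (layers a (suc n)) ω ≡ δ + eval (layers (a + δ) n) ω
      head-∈ a n {ω} a∈ lt = cong (_+ eval (layers (a + δ) n) ω)
        (trans (cong (δ *_) (𝟙-∈ {A ∩ (λ ω → a + δ < X ω)} (a∈ , lt))) (*-identityʳ δ))

    layers-∉ : ∀ a n {ω} → ¬ A ω → eval (layers a n) ω ≡ 0ℝ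
    layers-∉ a zero    ∉ = refl
    layers-∉ a (suc n) ∉ = trans (head-∉ a n (∉ ∘ proj₁)) (layers-∉ (a + δ) n ∉)

    layers-below : ∀ a n {ω} → X ω ≤ a → eval (layers a n) ω ≡ 0ℝ
    layers-below a zero    X≤a = refl
    layers-below a (suc n) X≤a = trans (head-∉ a n (λ (_ , lt) → lt X≤a+δ)) (layers-below (a + δ) n X≤a+δ)
      where X≤a+δ = ≤-trans X≤a (≤+nonneg 0≤δ)

    layers-≤ : ∀ a n {ω} → a ≤ X ω → eval (layers a n) ω + a ≤ X ω
    layers-≤ a zero    {ω} a≤X = subst (_≤ X ω) (sym (+-identityˡ a)) a≤X
    layers-≤ a (suc n) {ω} a≤X = step (dec (A ω × a + δ < X ω))
      where
      e = eval (layers (a + δ) n) ω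
      rest : ¬ (A ω × a + δ < X ω) → Dec (A ω) → e ≡ 0ℝ
      rest ∉ (yes a∈) = layers-below (a + δ) n (by-contradiction λ lt → ∉ (a∈ , lt))
      rest ∉ (no ¬a)  = layers-∉ (a + δ) n ¬a
      step : Dec (A ω × a + δ < X ω) → eval (layers a (suc n)) ω + a ≤ X ω
      step (yes (a∈ , lt)) = subst (_≤ X ω) (trans
        (solve 3 (λ e a d → e :+ (a :+ d) := (d :+ e) :+ a) refl e a δ)
        (cong (_+ a) (sym (head-∈ a n a∈ lt)))) (layers-≤ (a + δ) n (<⇒≤ lt))
      step (no ∉) = subst (λ z → z + a ≤ X ω) (sym (trans (head-∉ a n ∉) (rest ∉ (dec (A ω)))))
        (subst (_≤ X ω) (sym (+-identityˡ a)) a≤X)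

    layers-≥ : ∀ a n {ω} → A ω → a ≤ X ω → X ω ≤ a + n · δ → X ω ≤ (eval (layers a n) ω + a) + δ
    layers-≥ a zero    {ω} a∈ a≤X X≤ = ≤-trans X≤ (lin 0≤δ
      (solve 2 (λ a d → (a :+ :0) :+ d := ((:0 :+ a) :+ d) :+ :0) refl a δ))
    layers-≥ a (suc n) {ω} a∈ a≤X X≤ with X ω ≤? a + δ
    ... | yes X≤a+δ = ≤-trans X≤a+δ (≤-reflexive (cong (_+ δ) (sym (trans (cong (_+ a)
            (trans (head-∉ a n (λ (_ , lt) → lt X≤a+δ)) (layers-below (a + δ) n X≤a+δ))) (+-identityˡ a)))))
    ... | no lt      = subst (λ z → X ω ≤ (z + a) + δ) (sym (head-∈ a n a∈ lt))
            (subst (X ω ≤_) (solve 3 (λ e a d → (e :+ (a :+ d)) :+ d := ((d :+ e) :+ a) :+ d) refl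
                               (eval (layers (a + δ) n) ω) a δ)
              (layers-≥ (a + δ) n a∈ (<⇒≤ lt)
                (subst (X ω ≤_) (sym (+-assoc a δ (n · δ))) X≤)))

    -- The n levels of height δ exhaust [0,1], so on A the staircase misses X by at most one level.
    layers-near : ∀ n {ω} → n · δ ≡ 1ℝ → 0ℝ ≤ X ω → X ω ≤ 1ℝ →
                  Near δ (X ω * 𝟙 A ω) (eval (layers 0ℝ n) ω)
    layers-near n {ω} nδ≡1 0≤X X≤1 with dec (A ω)
    ... | yes a∈ = subst₂ (Near δ) (sym (*-identityʳ _)) refl
            ( subst (λ z → X ω ≤ z + δ) (+-identityʳ _)
                (layers-≥ 0ℝ n a∈ 0≤X (subst (X ω ≤_) (sym (trans (+-identityˡ _) nδ≡1)) X≤1))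
            , ≤-trans (subst (_≤ X ω) (+-identityʳ _) (layers-≤ 0ℝ n 0≤X)) (≤+nonneg 0≤δ) )
    ... | no ¬a  = subst₂ (Near δ) (sym (zeroʳ _)) (sym (layers-∉ 0ℝ n ¬a)) (near-refl 0≤δ)

    -- Valid without bounds on X. Under a law, coordinates may leave [0,1] at vectors that the
    -- random vector never takes, and `layers-near` does not apply there.
    layers-positive : ∀ n {ω} → 0ℝ < eval (layers 0ℝ n) ω → A ω × eval (layers 0ℝ n) ω ≤ X ω
    layers-positive n {ω} pos =
      by-contradiction (λ ∉ → pos (≤-reflexive (layers-∉ 0ℝ n ∉))) ,
      subst (_≤ X ω) (+-identityʳ _) (layers-≤ 0ℝ n
        (<⇒≤ λ X≤0 → pos (≤-reflexive (layers-below 0ℝ n X≤0))))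

-- Transfer between a probability space and a law

module PushForward (em : ExcludedMiddle (lsuc 0ℓ)) (R : Reals)
                   {Ω : Set} {ℱ : Probability.SigmaAlgebra R Ω}
                   (ℙ : Probability.ProbabilityMeasure R ℱ) {k : ℕ} {f : Ω → Vector (Reals.ℝ R) k}
                   (mf : ∀ i → Probability.SigmaAlgebra.MeasurableFunction ℱ (λ ω → f ω i)) where
  open Analysis em R
  open Nearness em R
  open Reals R
  open Probability R using (module SigmaAlgebra; SimpleBelow; IsIntegral; IsExpectation; lawOf; preimage; Borel; gen)
  module S  = SimpleFunctions em R ℱ
  module Sᵏ = SimpleFunctions em R (Borel k)
  open Sᵏ using (term)
  open Measure em R ℙ using (val)
  open Measure em R (lawOf ℙ {f = f} mf) using () renaming (val to lawVal)
  open Integrals em R ℙ using (integral-near)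
  open Integration em R (lawOf ℙ {f = f} mf) using (simpleBelow)

  pullback : Sᵏ.Simple → S.Simple
  pullback []              = []
  pullback (term c mA ∷ φ) = S.term c (preimage ℱ mf mA) ∷ pullback φ

  eval-pullback : ∀ φ ω → S.eval (pullback φ) ω ≡ Sᵏ.eval φ (f ω)
  eval-pullback []                  ω = refl
  eval-pullback (term c {A} mA ∷ φ) ω = cong (c * Sᵏ.𝟙 A (f ω) +_) (eval-pullback φ ω)

  val-pullback : ∀ φ → val (pullback φ) ≡ lawVal φ
  val-pullback []              = refl
  val-pullback (term c mA ∷ φ) = cong (c * _ +_) (val-pullback φ)

  module _ (i : Fin k) (0≤f : ∀ ω → 0ℝ ≤ f ω i) (f≤1 : ∀ ω → f ω i ≤ 1ℝ) where

    -- The approximating simple function lives on the space of values, so each of its sets yields an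
    -- event about f alone; independence can be applied to such events.
    layers-integral : ∀ {A} (mA : SigmaAlgebra.Measurable (Borel k) A) {p} →
      IsIntegral ℙ (A ∘ f) (λ ω → f ω i) p → ∀ {ε} → 0ℝ < ε →
      Σ[ φ ∈ Sᵏ.Simple ] (∀ ω → Near ε (f ω i * S.𝟙 (A ∘ f) ω) (Sᵏ.eval φ (f ω)))
        × Near ε p (val (pullback φ))
        × (∀ {s} → 0ℝ < Sᵏ.eval φ s → A s × Sᵏ.eval φ s ≤ s i)
    layers-integral {A} mA {p} int {ε} 0<ε = φ , near , near-p , layers-positive mA (gen i) 0≤δ (suc m)
      where
      open Layers em R (Borel k)
      m = proj₁ (1/suc-small 0<ε)
      0≤δ = 0≤1/suc m
      φ = layers mA (gen i) 0≤δ 0ℝ (suc m)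
      near : ∀ ω → Near ε (f ω i * S.𝟙 (A ∘ f) ω) (Sᵏ.eval φ (f ω))
      near ω = near-mono (proj₂ (1/suc-small 0<ε))
        (layers-near mA (gen i) 0≤δ (suc m) (suc·1/suc≡1 m) (0≤f ω) (f≤1 ω))
      near-p : Near ε p (val (pullback φ))
      near-p = integral-near 0≤f int (pullback φ) ε
        λ ω → subst (Near ε _) (sym (eval-pullback φ ω)) (near ω)

    -- The algorithm sees laws, while marginals are expectations over Ω. Simple functions under the
    -- law pull back to Ω; conversely, the layers are simple functions of f already.
    law-expectation : ∀ {p} → IsExpectation ℙ (λ ω → f ω i) p → IsExpectation (lawOf ℙ {f = f} mf) (λ s → s i) p
    law-expectation {p} int = (λ { (ψ , refl) → proj₁ int (pullbackBelow ψ , refl) }) ,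
        λ ub → ≤-by-ε λ 0<ε → bound ub (layers-integral (SigmaAlgebra.universe (Borel k)) int 0<ε)
      where
      pullbackBelow : SimpleBelow (lawOf ℙ {f = f} mf) U (λ s → s i) → SimpleBelow ℙ U (λ ω → f ω i)
      pullbackBelow ψ = record
        { size = size ; coefficient = coefficient ; piece = λ j → piece j ∘ f
        ; measurable = λ j → preimage ℱ mf (measurable j) ; nonneg = nonneg
        ; disjoint = disjoint ; within = λ _ _ → _ ; below = λ j → below j }
        where open SimpleBelow ψ

      bound : ∀ {b ε} →
        UpperBound _≤_ (λ y → Σ[ ψ ∈ SimpleBelow (lawOf ℙ {f = f} mf) U (λ s → s i) ] y ≡ SimpleBelow.value ψ) b →
        Σ[ φ ∈ Sᵏ.Simple ] (∀ ω → Near ε (f ω i * S.𝟙 U ω) (Sᵏ.eval φ (f ω)))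
          × Near ε p (val (pullback φ)) × (∀ {s} → 0ℝ < Sᵏ.eval φ s → ⊤ × Sᵏ.eval φ s ≤ s i) →
        p ≤ b + ε
      bound {b} {ε} ub (φ , _ , (p≤φ , _) , positive) = ≤-trans p≤φ (+-monoˡ-≤ ε
        (≤-trans (≤-reflexive (val-pullback φ)) (≤-trans (proj₂ below-φ)
          (subst (_≤ b) (sym (+-identityʳ _)) (ub (proj₁ below-φ , refl))))))
        where
        below-φ = simpleBelow φ 0ℝ λ s 0<φ →
          _ , subst (Sᵏ.eval φ s ≤_) (sym (+-identityʳ (s i))) (proj₂ (positive {s} 0<φ))

-- Independence of the random vectors

module Independence (em : ExcludedMiddle (lsuc 0ℓ)) (R : Reals) {n : ℕ} {G : Graph n} {σ : ArrivalOrder n}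
                    (𝐫 : VertexArrival.RandomBatches R G σ) where
  open Analysis em R
  open Nearness em R
  open Reals R
  open Probability R using (module SigmaAlgebra; module ProbabilityMeasure; Borel; preimage; univ)
  open VertexArrival R
  open RandomBatches 𝐫 hiding (nonneg)
  open SigmaAlgebra using (Measurable)
  open ProbabilityMeasure ℙ
  open MeasurableSets em R ℱ
  open SimpleFunctions em R ℱ
  open SimpleFunctions em R (Borel n) using () renaming (Simple to Simpleⁿ; eval to evalⁿ; term to termⁿ)
  open Measure em R ℙ
  open Integrals em R ℙ
  open PushForward em R ℙ using (pullback)

  private module Product = Algebra.Properties.CommutativeMonoid.Sum *-commutativeMonoid

  product-change : ∀ {m} (v : Fin m) {g h : Vector ℝ m} → (∀ w → w ≢ v → g w ≡ h w) → h v ≡ 1ℝ →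
                   product g ≡ g v * product h
  product-change {suc m} v {g} {h} g≡h hv≡1 = trans (Product.sum-remove {i = v} g) (cong (g v *_)
    (trans (Product.sum-cong-≗ λ w → g≡h (punchIn v w) (punchInᵢ≢i v w))
      (sym (trans (Product.sum-remove {i = v} h)
        (trans (cong (_* product (removeAt h v)) hv≡1) (*-identityˡ _))))))

  Family : Set₁
  Family = Fin n → Pred (Vector ℝ n) 0ℓ

  MeasurableFamily : Family → Set₁
  MeasurableFamily A = ∀ v → Measurable (Borel n) (A v)

  Event : Family → Pred Ω 0ℓ
  Event A = ⋂ (Fin n) (λ v → A v ∘ r v)

  preimages : ∀ {A} → MeasurableFamily A → ∀ v → Measurable ℱ (A v ∘ r v)
  preimages mA v = preimage ℱ (measurable v) (mA v)

  event : ∀ {A} → MeasurableFamily A → Measurable ℱ (Event A)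
  event mA = ⋂-measurable (preimages mA)

  infixl 9 _[_≔_]
  _[_≔_] : Family → Fin n → Pred (Vector ℝ n) 0ℓ → Family
  (A [ v ≔ H ]) w with w ≟ v
  ... | yes _ = H
  ... | no _  = A w

  ≔-measurable : ∀ {A} → MeasurableFamily A → ∀ v {H} → Measurable (Borel n) H → MeasurableFamily (A [ v ≔ H ])
  ≔-measurable mA v mH w with w ≟ v
  ... | yes _ = mH
  ... | no _  = mA w

  module _ {A : Family} (mA : MeasurableFamily A) {v : Fin n} (Av : ∀ s → A v s)
           {H : Pred (Vector ℝ n) 0ℓ} (mH : Measurable (Borel n) H) where

    Event-≔ : Event (A [ v ≔ H ]) ≐ (H ∘ r v) ∩ Event A
    Event-≔ = (λ e → at (e v) , λ w → other w (e w)) , λ (h , e) w → back w h (e w)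
      where
      at : ∀ {s} → (A [ v ≔ H ]) v s → H s
      at e with v ≟ v
      ... | yes _  = e
      ... | no v≢v = contradiction refl v≢v
      other : ∀ w {s} → (A [ v ≔ H ]) w s → A w s
      other w e with w ≟ v
      ... | yes refl = Av _
      ... | no _     = e
      back : ∀ w {ω} → H (r v ω) → A w (r w ω) → (A [ v ≔ H ]) w (r w ω)
      back w h a with w ≟ v
      ... | yes refl = h
      ... | no _     = a

    -- Independence applied to both families: the products differ only at v, where the unconstrained
    -- family has the factor 1.
    P-Event-≔ : P (event (≔-measurable mA v mH)) ≡ P (preimage ℱ (measurable v) mH) * P (event mA)
    P-Event-≔ = trans (independent mA′ (event mA′))
      (trans (product-change v other (trans (P-cong _ (SigmaAlgebra.universe ℱ) (_ , λ _ → Av _)) total))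
        (cong₂ _*_ at (sym (independent mA (event mA)))))
      where
      mA′ = ≔-measurable mA v mH
      at : P (preimages mA′ v) ≡ P (preimage ℱ (measurable v) mH)
      at with v ≟ v
      ... | yes _  = refl
      ... | no v≢v = contradiction refl v≢v
      other : ∀ w → w ≢ v → P (preimages mA′ w) ≡ P (preimages mA w)
      other w w≢v with w ≟ v
      ... | yes w≡v = contradiction w≡v w≢v
      ... | no _    = refl

  -- f has mean e and is independent of the vectors 𝐫ᵛ with v ∉ T.
  IndependentOutside : Pred (Fin n) 0ℓ → (Ω → ℝ) → ℝ → Set₁
  IndependentOutside T f e = ∀ {A} (mA : MeasurableFamily A) → (∀ {v} → T v → ∀ s → A v s) →
    Int (λ ω → f ω * 𝟙 (Event A) ω) (e * P (event mA))

  module _ {T : Pred (Fin n) 0ℓ} where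

    Ind-cong : ∀ {f g d e} → (∀ ω → f ω ≡ g ω) → d ≡ e → IndependentOutside T f d → IndependentOutside T g e
    Ind-cong f≗g d≡e I {A} mA trivial =
      Int-cong (λ ω → cong (_* 𝟙 (Event A) ω) (f≗g ω)) (cong (_* P (event mA)) d≡e) (I mA trivial)

    Ind-⊆ : ∀ {S f e} → S ⊆ T → IndependentOutside S f e → IndependentOutside T f e
    Ind-⊆ S⊆T I mA trivial = I mA (trivial ∘ S⊆T)

    Ind-1 : IndependentOutside T (λ _ → 1ℝ) 1ℝ
    Ind-1 mA _ = Int-cong (λ ω → sym (*-identityˡ _)) (sym (*-identityˡ _)) (Int-𝟙 (event mA))

    Ind-+ : ∀ {f g d e} → IndependentOutside T f d → IndependentOutside T g e →
            IndependentOutside T (λ ω → f ω + g ω) (d + e)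
    Ind-+ I J mA trivial = Int-cong (λ ω → sym (distribʳ _ _ _)) (sym (distribʳ _ _ _))
      (Int-+ (I mA trivial) (J mA trivial))

    Ind-* : ∀ c {f e} → IndependentOutside T f e → IndependentOutside T (λ ω → c * f ω) (c * e)
    Ind-* c I mA trivial = Int-cong (λ ω → sym (*-assoc _ _ _)) (sym (*-assoc _ _ _)) (Int-* c (I mA trivial))

    Ind-sum : ∀ {m} {f : Fin m → Ω → ℝ} {e : Vector ℝ m} → (∀ i → IndependentOutside T (f i) (e i)) →
              IndependentOutside T (λ ω → sum (λ i → f i ω)) (sum e)
    Ind-sum {zero}  I = Ind-cong (λ ω → zeroˡ _) (zeroˡ _) (Ind-* 0ℝ Ind-1)
    Ind-sum {suc m} I = Ind-+ (I zero) (Ind-sum (I ∘ suc))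

    Ind-Int : ∀ {f e} → IndependentOutside T f e → Int f e
    Ind-Int I = Int-cong
      (λ ω → trans (cong (_ *_) (𝟙-∈ {Event (λ _ → U)} {ω} (λ _ → _))) (*-identityʳ _))
      (trans (cong (_ *_) (trans (P-cong _ (SigmaAlgebra.universe ℱ) (_ , _)) total)) (*-identityʳ _))
      (I {λ _ → U} (λ _ → univ) (λ _ _ → _))

  -- h is a uniform limit of simple functions of 𝐫ᵛ, and x is its mean.
  Approximated : Fin n → (Ω → ℝ) → ℝ → Set₁
  Approximated v h x = ∀ {ε} → 0ℝ < ε → Σ[ φ ∈ Simpleⁿ ]
    (∀ ω → Near ε (h ω) (evalⁿ φ (r v ω))) × Near ε x (val (pullback (measurable v) φ))

  module _ {S T : Pred (Fin n) 0ℓ} (S⊆T : S ⊆ T) {v : Fin n} (v∈T : T v) (v∉S : ¬ S v)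
           {f : Ω → ℝ} {e : ℝ} (I : IndependentOutside S f e) where

    private
      -- Multiplying by the indicator of 𝐫ᵛ ∈ H constrains the product event at v, which the
      -- independence of f allows because v is not in S. Linearity does the rest.
      Ind-simple : ∀ φ → IndependentOutside T (λ ω → f ω * evalⁿ φ (r v ω)) (e * val (pullback (measurable v) φ))
      Ind-simple [] = Ind-cong (λ ω → trans (zeroˡ (f ω)) (sym (zeroʳ (f ω)))) (trans (zeroˡ e) (sym (zeroʳ e)))
                        (Ind-* 0ℝ (Ind-⊆ S⊆T I))
      Ind-simple (termⁿ c {H} mH ∷ φ) {A} mA trivial = Int-cong
        (λ ω → trans
          (cong (λ z → c * (f ω * z) + (f ω * evalⁿ φ (r v ω)) * 𝟙 (Event A) ω)
            (trans (𝟙-cong (Event-≔ mA (trivial v∈T) mH) ω) (𝟙-∩ (H ∘ r v) (Event A) ω)))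
          (expand c (f ω) (𝟙 (H ∘ r v) ω) (𝟙 (Event A) ω) (evalⁿ φ (r v ω))))
        (trans (cong (λ z → c * (e * z) + (e * val (pullback (measurable v) φ)) * P (event mA))
                 (P-Event-≔ mA (trivial v∈T) mH))
          (expand c e (P (preimage ℱ (measurable v) mH)) (P (event mA)) (val (pullback (measurable v) φ))))
        (Int-+ (Int-* c (I (≔-measurable mA v mH) trivial′)) (Ind-simple φ mA trivial))
        where
        expand : ∀ c f h a g → c * (f * (h * a)) + (f * g) * a ≡ (f * (c * h + g)) * a
        expand = solve 5 (λ c f h a g → c :* (f :* (h :* a)) :+ (f :* g) :* a := (f :* (c :* h :+ g)) :* a) refl
        trivial′ : ∀ {w} → S w → ∀ s → (A [ v ≔ H ]) w s
        trivial′ {w} Sw s with w ≟ v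
        ... | yes refl = contradiction Sw v∉S
        ... | no _     = trivial (S⊆T Sw) s

    -- The product rule for means. As f and e lie in [0,1], replacing h by a simple function costs
    -- no more than its own error.
    Ind-multiply : (∀ ω → 0ℝ ≤ f ω) → (∀ ω → f ω ≤ 1ℝ) → 0ℝ ≤ e → e ≤ 1ℝ →
      ∀ {h x} → Approximated v h x → IndependentOutside T (λ ω → f ω * h ω) (e * x)
    Ind-multiply 0≤f f≤1 0≤e e≤1 approx {A} mA trivial = Int-limit λ 0<ε →
      let φ , near , near-x = approx 0<ε
          0≤ε = <⇒≤ 0<ε
      in _ , _ , (λ ω → restrict 0≤ε (𝟙-nonneg (Event A) ω) (𝟙-≤1 (Event A) ω) (near-*-≤1 (f ω) 0≤ε (0≤f ω) (f≤1 ω) (near ω)))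
         , restrict 0≤ε (nonneg (event mA)) (P≤1 (event mA)) (near-*-≤1 e 0≤ε 0≤e e≤1 near-x)
         , Ind-simple φ mA trivial
      where
      restrict : ∀ {ε a b c} → 0ℝ ≤ ε → 0ℝ ≤ c → c ≤ 1ℝ → Near ε a b → Near ε (a * c) (b * c)
      restrict {c = c} 0≤ε 0≤c c≤1 n = subst₂ (Near _) (*-comm _ _) (*-comm _ _) (near-*-≤1 c 0≤ε 0≤c c≤1 n)

-- Free vertices and matchings

snoc : ∀ {a} {A : Set a} {k} → Vector A k → A → Vector A (suc k)
snoc {k = zero}  xs x _       = x
snoc {k = suc k} xs x zero    = xs zero
snoc {k = suc k} xs x (suc i) = snoc (xs ∘ suc) x i

snoc-inject₁ : ∀ {a} {A : Set a} {k} (xs : Vector A k) x i → snoc xs x (inject₁ i) ≡ xs i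
snoc-inject₁ {k = suc k} xs x zero    = refl
snoc-inject₁ {k = suc k} xs x (suc i) = snoc-inject₁ (xs ∘ suc) x i

snoc-fromℕ : ∀ {a} {A : Set a} {k} (xs : Vector A k) x → snoc xs x (fromℕ k) ≡ x
snoc-fromℕ {k = zero}  xs x = refl
snoc-fromℕ {k = suc k} xs x = snoc-fromℕ (xs ∘ suc) x

isEmpty : ∀ {k} → Subset k → Bool
isEmpty []            = true
isEmpty (inside  ∷ D) = false
isEmpty (outside ∷ D) = isEmpty D

isEmpty⇒∉ : ∀ {k} (D : Subset k) → isEmpty D ≡ true → ∀ {i} → ¬ i ∈ D
isEmpty⇒∉ (outside ∷ D) e (there p) = isEmpty⇒∉ D e p

free : ∀ {k} → Selections k → Vector Bool k
free []      = λ ()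
free (I ▷ D) = snoc (λ i → free I i ∧ not (lookup D i)) (isEmpty D)

Selected-bounds : ∀ {k} {I : Selections k} {a b} → Selected I a b → a ℕ.< b × b ℕ.< k
Selected-bounds (here {i = i} _) = toℕ<n i , ℕ.n<1+n _
Selected-bounds (there p)        = let a<b , b<k = Selected-bounds p in a<b , ℕ.m<n⇒m<1+n b<k

∧-true : ∀ {a b} → a ∧ b ≡ true → a ≡ true × b ≡ true
∧-true {true} {true} refl = refl , refl

-- Earlier edges have both ends below k, so only D can match the newest vertex; an older vertex can
-- meet an edge of D only at that edge's smaller end.
free⇒unmatched : ∀ {k} (I : Selections k) i → free I i ≡ true →
                 ∀ {a b} → Selected I a b → toℕ i ≢ a × toℕ i ≢ b
free⇒unmatched {suc k} (I ▷ D) i f p with view i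
... | ‵fromℕ rewrite snoc-fromℕ (λ i → free I i ∧ not (lookup D i)) (isEmpty D) | toℕ-fromℕ k with p
...   | here q  = contradiction q (isEmpty⇒∉ D f)
...   | there q = let a<b , b<k = Selected-bounds q in
                  ℕ.<⇒≢ (ℕ.<-trans a<b b<k) ∘ sym , ℕ.<⇒≢ b<k ∘ sym
free⇒unmatched {suc k} (I ▷ D) i f p | ‵inject₁ j
  rewrite snoc-inject₁ (λ i → free I i ∧ not (lookup D i)) (isEmpty D) j | toℕ-inject₁ j
  with ∧-true {free I j} f | p
... | fj , j∉D | there q = free⇒unmatched I j fj q
... | fj , j∉D | here {i = i′} i′∈D = apart , ℕ.<⇒≢ (toℕ<n j)
  where
  apart : toℕ j ≢ toℕ i′
  apart j≡i′ with toℕ-injective j≡i′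
  ... | refl rewrite []=⇒lookup i′∈D = contradiction j∉D λ ()

-- All edges of D share the new vertex, so D needs uniqueness. An older edge can meet an edge of D
-- only at the older end of the latter, which is free.
▷-matching : ∀ {k} {I : Selections k} {D : Subset k} → IsMatching I →
             (∀ {i} → i ∈ D → free I i ≡ true) → (∀ {i j} → i ∈ D → j ∈ D → i ≡ j) →
             IsMatching (I ▷ D)
▷-matching M fr uniq (here i∈D) (here j∈D) _ = cong toℕ (uniq i∈D j∈D) , refl
▷-matching M fr uniq (there p)  (there q)  c = M p q c
▷-matching {I = I} M fr uniq (here {i = i} i∈D) (there q) c = ⊥-elim (clash c)
  where
  a<b,b<k = Selected-bounds q
  unmatched = free⇒unmatched I i (fr i∈D) q
  clash : _ → ⊥
  clash (inj₁ e)               = proj₁ unmatched e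
  clash (inj₂ (inj₁ e))        = proj₂ unmatched e
  clash (inj₂ (inj₂ (inj₁ e))) = ℕ.<⇒≢ (ℕ.<-trans (proj₁ a<b,b<k) (proj₂ a<b,b<k)) (sym e)
  clash (inj₂ (inj₂ (inj₂ e))) = ℕ.<⇒≢ (proj₂ a<b,b<k) (sym e)
▷-matching {I = I} M fr uniq (there p) (here {i = i} i∈D) c = ⊥-elim (clash c)
  where
  a<b,b<k = Selected-bounds p
  unmatched = free⇒unmatched I i (fr i∈D) p
  clash : _ → ⊥
  clash (inj₁ e)               = proj₁ unmatched (sym e)
  clash (inj₂ (inj₁ e))        = ℕ.<⇒≢ (ℕ.<-trans (proj₁ a<b,b<k) (proj₂ a<b,b<k)) e
  clash (inj₂ (inj₂ (inj₁ e))) = proj₂ unmatched (sym e)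
  clash (inj₂ (inj₂ (inj₂ e))) = ℕ.<⇒≢ (proj₂ a<b,b<k) e

-- Drawing at most one element

module StickBreaking (em : ExcludedMiddle (lsuc 0ℓ)) (R : Reals) where
  open Analysis em R
  open Reals R
  open VertexArrival R using (sumSubsets)
  open Probability R using (SigmaAlgebra; module SigmaAlgebra)

  sumSubsets-cong : ∀ k {f g : Subset k → ℝ} → (∀ D → f D ≡ g D) → sumSubsets k f ≡ sumSubsets k g
  sumSubsets-cong zero    e = e []
  sumSubsets-cong (suc k) e = cong₂ _+_ (sumSubsets-cong k (λ D → e _)) (sumSubsets-cong k (λ D → e _))

  sumSubsets-0 : ∀ k {f : Subset k → ℝ} → (∀ D → f D ≡ 0ℝ) → sumSubsets k f ≡ 0ℝ
  sumSubsets-0 zero    e = e []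
  sumSubsets-0 (suc k) e = trans (cong₂ _+_ (sumSubsets-0 k (λ D → e _)) (sumSubsets-0 k (λ D → e _))) (+-identityʳ 0ℝ)

  sumSubsets-+ : ∀ k (f g : Subset k → ℝ) → sumSubsets k (λ D → f D + g D) ≡ sumSubsets k f + sumSubsets k g
  sumSubsets-+ zero    f g = refl
  sumSubsets-+ (suc k) f g = trans (cong₂ _+_ (sumSubsets-+ k _ _) (sumSubsets-+ k _ _))
    (solve 4 (λ a b c d → (a :+ b) :+ (c :+ d) := (a :+ c) :+ (b :+ d)) refl _ _ _ _)

  sumSubsets-* : ∀ k c (f : Subset k → ℝ) → sumSubsets k (λ D → c * f D) ≡ c * sumSubsets k f
  sumSubsets-* zero    c f = refl
  sumSubsets-* (suc k) c f = trans (cong₂ _+_ (sumSubsets-* k c _) (sumSubsets-* k c _)) (sym (distribˡ _ _ _))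

  sumSubsets-empty : ∀ k y → sumSubsets k (λ D → if isEmpty D then y else 0ℝ) ≡ y
  sumSubsets-empty zero    y = refl
  sumSubsets-empty (suc k) y = trans (cong₂ _+_ (sumSubsets-0 k λ _ → refl) (sumSubsets-empty k y)) (+-identityˡ y)

  -- A unit-mass distribution on the empty set and the singletons: as long as the weights do
  -- not exceed the available mass c, {i} receives wᵢ and ∅ the remainder.
  stick : ∀ {k} → ℝ → Vector ℝ k → Subset k → ℝ
  stick c w []            = c
  stick c w (inside  ∷ D) = if isEmpty D then c ⊓ head w else 0ℝ
  stick c w (outside ∷ D) = stick (c + - (c ⊓ head w)) (tail w) D

  stick-total : ∀ {k} c (w : Vector ℝ k) → sumSubsets k (stick c w) ≡ c
  stick-total {zero}  c w = refl
  stick-total {suc k} c w = trans (cong₂ _+_ (sumSubsets-empty k _) (stick-total _ (tail w)))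
    (solve 2 (λ c m → m :+ (c :+ :- m) := c) refl c (c ⊓ head w))

  remainder-nonneg : ∀ c w → 0ℝ ≤ c + - (c ⊓ w)
  remainder-nonneg c w = ≤⇒0≤- (⊓-≤ˡ c w)

  stick-nonneg : ∀ {k c} {w : Vector ℝ k} → 0ℝ ≤ c → (∀ i → 0ℝ ≤ w i) → ∀ D → 0ℝ ≤ stick c w D
  stick-nonneg 0≤c 0≤w []            = 0≤c
  stick-nonneg 0≤c 0≤w (outside ∷ D) = stick-nonneg (remainder-nonneg _ _) (0≤w ∘ suc) D
  stick-nonneg 0≤c 0≤w (inside  ∷ D) with isEmpty D
  ... | true  = ⊓-nonneg 0≤c (0≤w zero)
  ... | false = ≤-refl

  -- A second element forces the value 0, and so does a zero weight, since c is nonnegative.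
  -- Feasibility of the algorithm rests on this.
  stick-support : ∀ {k c} {w : Vector ℝ k} → 0ℝ ≤ c → ∀ D → stick c w D ≢ 0ℝ →
    (∀ {i} → i ∈ D → w i ≢ 0ℝ) × (∀ {i j} → i ∈ D → j ∈ D → i ≡ j)
  stick-support 0≤c [] _ = (λ ()) , λ ()
  stick-support 0≤c (outside ∷ D) s≢0 with stick-support (remainder-nonneg _ _) D s≢0
  ... | w≢0 , uniq = (λ { (there p) → w≢0 p }) ,
        λ { (there p) (there q) → cong suc (uniq p q) }
  stick-support {w = w} 0≤c (inside ∷ D) s≢0 with isEmpty D in e
  ... | false = contradiction refl s≢0
  ... | true  =
    (λ { here w≡0 → s≢0 (trans (⊓-≥ (subst (_≤ _) (sym w≡0) 0≤c)) w≡0)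
       ; (there p) → contradiction p (isEmpty⇒∉ D e) }) ,
    λ { here here → refl
      ; (there p) _ → contradiction p (isEmpty⇒∉ D e)
      ; _ (there q) → contradiction q (isEmpty⇒∉ D e) }

  sum-nonneg : ∀ {k} {w : Vector ℝ k} → (∀ i → 0ℝ ≤ w i) → 0ℝ ≤ sum w
  sum-nonneg {zero}  0≤w = ≤-refl
  sum-nonneg {suc k} 0≤w = +-nonneg (0≤w zero) (sum-nonneg (0≤w ∘ suc))

  module _ {k c} {w : Vector ℝ (suc k)} (0≤w : ∀ i → 0ℝ ≤ w i) (w≤c : sum w ≤ c) where

    -- When the weights fit into the mass c, the minimum does not truncate, and the remaining
    -- weights fit into the remaining mass.
    head-fits : c ⊓ head w ≡ head w
    head-fits = ⊓-≥ (≤-trans (≤+nonneg (sum-nonneg (0≤w ∘ suc))) w≤c)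

    tail-fits : sum (tail w) ≤ c + - (c ⊓ head w)
    tail-fits = subst (λ z → sum (tail w) ≤ c + - z) (sym head-fits)
      (lin w≤c (solve 3 (λ c w v → v :+ c := (c :+ :- w) :+ (w :+ v)) refl c (head w) (sum (tail w))))

  stick-singleton : ∀ {k c} {w : Vector ℝ k} → (∀ i → 0ℝ ≤ w i) → sum w ≤ c → ∀ i →
    sumSubsets k (λ D → if lookup D i then stick c w D else 0ℝ) ≡ w i
  stick-singleton {suc k} {c} {w} 0≤w w≤c zero = trans
    (cong₂ _+_ (trans (sumSubsets-empty k _) (head-fits 0≤w w≤c)) (sumSubsets-0 k λ _ → refl)) (+-identityʳ _)
  stick-singleton {suc k} {c} {w} 0≤w w≤c (suc i) = trans
    (cong₂ _+_ (sumSubsets-0 k apart) (stick-singleton (0≤w ∘ suc) (tail-fits 0≤w w≤c) i)) (+-identityˡ _)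
    where
    apart : ∀ D → (if lookup D i then (if isEmpty D then c ⊓ head w else 0ℝ) else 0ℝ) ≡ 0ℝ
    apart D with lookup D i in i∈D | isEmpty D in e
    ... | false | _     = refl
    ... | true  | false = refl
    ... | true  | true  = contradiction (lookup⇒[]= i D i∈D) (isEmpty⇒∉ D e)

  stick-empty : ∀ {k c} {w : Vector ℝ k} → (∀ i → 0ℝ ≤ w i) → sum w ≤ c →
    sumSubsets k (λ D → if isEmpty D then stick c w D else 0ℝ) ≡ c + - sum w
  stick-empty {zero}  {c}     0≤w w≤c = solve 1 (λ c → c := c :+ :- :0) refl c
  stick-empty {suc k} {c} {w} 0≤w w≤c = trans
    (cong₂ _+_ (sumSubsets-0 k λ _ → refl) (stick-empty (0≤w ∘ suc) (tail-fits 0≤w w≤c)))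
    (trans (cong (λ z → 0ℝ + ((c + - z) + - sum (tail w))) (head-fits 0≤w w≤c))
      (solve 3 (λ c w v → :0 :+ ((c :+ :- w) :+ :- v) := c :+ :- (w :+ v)) refl c (head w) (sum (tail w))))

  module _ {Ω : Set} (ℱ : SigmaAlgebra Ω) where
    open SigmaAlgebra ℱ
    open MeasurableSets em R ℱ

    stick-measurable : ∀ {k} {c : Ω → ℝ} {w : Ω → Vector ℝ k} → MeasurableFunction c →
      (∀ i → MeasurableFunction (λ ω → w ω i)) → ∀ D → MeasurableFunction (λ ω → stick (c ω) (w ω) D)
    stick-measurable mc mw []            = mc
    stick-measurable mc mw (outside ∷ D) = stick-measurable
      (+-measurable mc (neg-measurable (⊓-measurable mc (mw zero)))) (mw ∘ suc) D
    stick-measurable mc mw (inside  ∷ D) with isEmpty D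
    ... | true  = ⊓-measurable mc (mw zero)
    ... | false = const-measurable 0ℝ

-- The online algorithm

module Algorithm (em : ExcludedMiddle (lsuc 0ℓ)) (R : Reals) where
  open Analysis em R
  open StickBreaking em R
  open Reals R
  open VertexArrival R
  open Arrival
  open Probability R using (module SigmaAlgebra; IsExpectation; generatedBy; gen)

  -- The probability with which a vertex that is free with probability d must accept an offer,
  -- for the overall acceptance probability to be ½; under (i) the junk case d < ½ does not occur.
  acceptance : ℝ → ℝ
  acceptance d with dec (½ ≤ d)
  ... | yes ½≤d = ½ * PositiveInverse.inv (positiveInverse {d} (<-≤-trans 0<½ ½≤d))
  ... | no _    = 0ℝ

  acceptance-nonneg : ∀ d → 0ℝ ≤ acceptance d
  acceptance-nonneg d with dec (½ ≤ d)
  ... | yes ½≤d = *-nonneg 0≤½ (PositiveInverse.0≤inv (positiveInverse (<-≤-trans 0<½ ½≤d)))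
  ... | no _    = ≤-refl

  acceptance-* : ∀ {d} → ½ ≤ d → acceptance d * d ≡ ½
  acceptance-* {d} ½≤d with dec (½ ≤ d)
  ... | no ¬½≤d = contradiction ½≤d ¬½≤d
  ... | yes p   = trans (solve 3 (λ h i d → h :* i :* d := h :* (d :* i)) refl ½ inv d)
                    (trans (cong (½ *_) x*inv≡1) (*-identityʳ ½))
    where open PositiveInverse (positiveInverse (<-≤-trans 0<½ p))

  acceptance-≤1 : ∀ {d} → ½ ≤ d → acceptance d ≤ 1ℝ
  acceptance-≤1 {d} ½≤d with dec (½ ≤ d)
  ... | no ¬½≤d = contradiction ½≤d ¬½≤d
  ... | yes p   = subst (½ * inv ≤_) x*inv≡1 (*-monoʳ-≤ 0≤inv p)
    where open PositiveInverse (positiveInverse (<-≤-trans 0<½ p))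

  -- 0 if the i-th coordinate has no finite mean.
  mean : ∀ {k} → Arrival k → Vector ℝ k
  mean a i with em {∃ (IsExpectation (law a) (λ s → s i))}
  ... | yes (e , _) = e
  ... | no _        = 0ℝ

  mean-unique : ∀ {k} (a : Arrival k) i {e} → IsExpectation (law a) (λ s → s i) e → mean a i ≡ e
  mean-unique a i E with em {∃ (IsExpectation (law a) (λ s → s i))}
  ... | yes (_ , E′) = Integrals.integral-unique em R (law a) E′ E
  ... | no ¬∃        = contradiction (_ , E) ¬∃

  -- Edge ij is selected with probability ½ xᵢⱼ, and a vertex is matched at most once.
  freeProb : ∀ {k} → Prefix Arrival k → Vector ℝ k
  freeProb []       = λ ()
  freeProb (as ▷ a) = snoc (λ i → freeProb as i + - (½ * mean a i)) (1ℝ + - (½ * sum (mean a)))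

  freeProb-inject₁ : ∀ {k} (as : Prefix Arrival k) a i →
    freeProb (as ▷ a) (inject₁ i) ≡ freeProb as i + - (½ * mean a i)
  freeProb-inject₁ as a = snoc-inject₁ (λ i → freeProb as i + - (½ * mean a i)) (1ℝ + - (½ * sum (mean a)))

  freeProb-fromℕ : ∀ {k} (as : Prefix Arrival k) a →
    freeProb (as ▷ a) (fromℕ k) ≡ 1ℝ + - (½ * sum (mean a))
  freeProb-fromℕ as a = snoc-fromℕ (λ i → freeProb as i + - (½ * mean a i)) (1ℝ + - (½ * sum (mean a)))

  gain : ∀ {k} → Prefix Arrival k → Arrival k → Selections k → Vector ℝ k
  gain as a I i = if lookup (batch a) i ∧ free I i then acceptance (freeProb as i) else 0ℝ

  -- Offer and acceptance fused into one draw. The positive part serves realizations with negative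
  -- entries, for which a distribution must be returned as well.
  weight : ∀ {k} → Prefix Arrival k → Arrival k → Selections k → Vector ℝ k → Vector ℝ k
  weight as a I s i = s i ⁺ * gain as a I i

  latest : ∀ {k} → Realizations (suc k) → Vector ℝ k
  latest (ss ▷ s) = s

  select : ∀ {k} → Prefix Arrival (suc k) → Realizations (suc k) → Selections k → Subset k → ℝ
  select (as ▷ a) ss I = stick 1ℝ (weight as a I (latest ss))

  gain-nonneg : ∀ {k} (as : Prefix Arrival k) a I i → 0ℝ ≤ gain as a I i
  gain-nonneg as a I i with lookup (batch a) i ∧ free I i
  ... | true  = acceptance-nonneg _
  ... | false = ≤-refl

  weight-nonneg : ∀ {k} (as : Prefix Arrival k) a I s i → 0ℝ ≤ weight as a I s i
  weight-nonneg as a I s i = *-nonneg (⁺-nonneg (s i)) (gain-nonneg as a I i)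

  weight≢0 : ∀ {k} (as : Prefix Arrival k) a I s i → weight as a I s i ≢ 0ℝ →
             lookup (batch a) i ≡ true × free I i ≡ true
  weight≢0 as a I s i w≢0 with lookup (batch a) i ∧ free I i in e
  ... | true  = ∧-true e
  ... | false = contradiction (zeroʳ _) w≢0

  -- `latest` and `coordinate (last i)` agree only after the sequence is split, hence the passage
  -- through `resp`.
  latest-measurable : ∀ {k} (i : Fin k) →
    SigmaAlgebra.MeasurableFunction (generatedBy (coordinate {suc k})) (λ ss → latest ss i)
  latest-measurable i q = SigmaAlgebra.resp (generatedBy coordinate)
    ((λ { {ss ▷ s} p → p }) , λ { {ss ▷ s} p → p }) (gen (last i) q)

  algorithm : OnlineAlgorithm
  algorithm = record
    { prob       = select
    ; nonneg     = λ { (as ▷ a) ss I → stick-nonneg 0≤1 (weight-nonneg as a I (latest ss)) }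
    ; total      = λ { (as ▷ a) ss I → stick-total 1ℝ (weight as a I (latest ss)) }
    ; measurable = λ { {k} (as ▷ a) I → stick-measurable (generatedBy (coordinate {suc k}))
        (const-measurable (generatedBy (coordinate {suc k})) 1ℝ)
        (λ i → *-measurable (generatedBy (coordinate {suc k})) (gain-nonneg as a I i)
          (⁺-measurable (generatedBy (coordinate {suc k})) (latest-measurable i))) }
    ; feasible   = λ as a ss I D (within , matching) p≢0 →
        let w≢0 , unique = stick-support 0≤1 D p≢0
            admissible   = λ {i} (i∈D : i ∈ D) → weight≢0 as a I (latest ss) i (w≢0 i∈D)
        in (within , λ i∈D → lookup⇒[]= _ (batch a) (proj₁ (admissible i∈D)))
         , ▷-matching matching (λ i∈D → proj₂ (admissible i∈D)) unique
    }
    where open MeasurableSets em R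

-- Sums over decision sequences and over vertices

module SelectionSums (em : ExcludedMiddle (lsuc 0ℓ)) (R : Reals) where
  open Analysis em R
  open StickBreaking em R
  open Reals R
  open VertexArrival R

  sumSubsets-mono : ∀ k {f g : Subset k → ℝ} → (∀ D → f D ≤ g D) → sumSubsets k f ≤ sumSubsets k g
  sumSubsets-mono zero    h = h _
  sumSubsets-mono (suc k) h = +-mono-≤ (sumSubsets-mono k (h ∘ _)) (sumSubsets-mono k (h ∘ _))

  sumSelections-cong : ∀ k {f g : Selections k → ℝ} → (∀ I → f I ≡ g I) → sumSelections k f ≡ sumSelections k g
  sumSelections-cong zero    e = e []
  sumSelections-cong (suc k) e = sumSelections-cong k λ I → sumSubsets-cong k λ D → e (I ▷ D)

  sumSelections-mono : ∀ k {f g : Selections k → ℝ} → (∀ I → f I ≤ g I) → sumSelections k f ≤ sumSelections k g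
  sumSelections-mono zero    h = h []
  sumSelections-mono (suc k) h = sumSelections-mono k λ I → sumSubsets-mono k λ D → h (I ▷ D)

  sumSelections-+ : ∀ k (f g : Selections k → ℝ) →
    sumSelections k (λ I → f I + g I) ≡ sumSelections k f + sumSelections k g
  sumSelections-+ zero    f g = refl
  sumSelections-+ (suc k) f g = trans (sumSelections-cong k λ I → sumSubsets-+ k _ _) (sumSelections-+ k _ _)

  sumSelections-* : ∀ k c (f : Selections k → ℝ) →
    sumSelections k (λ I → c * f I) ≡ c * sumSelections k f
  sumSelections-* zero    c f = refl
  sumSelections-* (suc k) c f = trans (sumSelections-cong k λ I → sumSubsets-* k c _) (sumSelections-* k c _)

  sumSelections-sum : ∀ k {m} (f : Fin m → Selections k → ℝ) →
    sumSelections k (λ I → sum (λ j → f j I)) ≡ sum (λ j → sumSelections k (f j))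
  sumSelections-sum k {zero}  f = trans (sumSelections-cong k λ _ → sym (zeroˡ 0ℝ))
    (trans (sumSelections-* k 0ℝ (λ _ → 0ℝ)) (zeroˡ _))
  sumSelections-sum k {suc m} f = trans (sumSelections-+ k (f zero) _)
    (cong (sumSelections k (f zero) +_) (sumSelections-sum k (f ∘ suc)))

module FiniteSums (em : ExcludedMiddle (lsuc 0ℓ)) (R : Reals) where
  open Analysis em R
  open StickBreaking em R
  open Reals R
  open Algebra.Properties.CommutativeMonoid.Sum +-commutativeMonoid public
    using (sum-cong-≗; sum-init-last; sum-permute)
  open Algebra.Properties.Semiring.Sum (CommutativeRing.semiring commutativeRing) public
    using (*-distribˡ-sum)

  sum-mono : ∀ {m} {f g : Vector ℝ m} → (∀ i → f i ≤ g i) → sum f ≤ sum g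
  sum-mono {zero}  h = ≤-refl
  sum-mono {suc m} h = +-mono-≤ (h zero) (sum-mono (h ∘ suc))

  sum-inject≤ : ∀ {k n} (f : Vector ℝ n) → (∀ i → 0ℝ ≤ f i) → (k≤n : k ℕ.≤ n) →
                sum {k} (λ i → f (inject≤ i k≤n)) ≤ sum f
  sum-inject≤ {zero}          f 0≤f k≤n = sum-nonneg 0≤f
  sum-inject≤ {suc k} {suc n} f 0≤f k≤n = +-mono-≤ ≤-refl (sum-inject≤ (f ∘ suc) (0≤f ∘ suc) (ℕ.s≤s⁻¹ k≤n))

inject≤-inject₁ : ∀ {k n} (i : Fin k) (k<n : k ℕ.< n) → inject≤ (inject₁ i) k<n ≡ inject≤ i (ℕ.<⇒≤ k<n)
inject≤-inject₁ i k<n = toℕ-injective (trans (toℕ-inject≤ _ k<n)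
  (trans (toℕ-inject₁ i) (sym (toℕ-inject≤ i (ℕ.<⇒≤ k<n)))))

inject≤-fromℕ : ∀ {k n} (k<n : k ℕ.< n) → inject≤ (fromℕ k) k<n ≡ fromℕ< k<n
inject≤-fromℕ {k} k<n = toℕ-injective (trans (toℕ-inject≤ _ k<n) (trans (toℕ-fromℕ k) (sym (toℕ-fromℕ< k<n))))

-- Marginals recovered from the laws

module Marginals (em : ExcludedMiddle (lsuc 0ℓ)) (R : Reals)
  {n : ℕ} {G : Graph n} {σ : ArrivalOrder n} (𝐫 : VertexArrival.RandomBatches R G σ)
  {x : Fin n → Fin n → Reals.ℝ R} (marginal : VertexArrival.IsMarginal R 𝐫 x)
  (Σx≤1 : ∀ v → Reals._≤_ R (Reals.sum R (λ u → x u v)) (Reals.1ℝ R)) where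
  open Analysis em R
  open StickBreaking em R using (sum-nonneg)
  open FiniteSums em R
  open Algorithm em R
  open Reals R
  open Graph G
  open VertexArrival R
  open Probability R using (IsExpectation)
  open RandomBatches 𝐫 hiding (nonneg)
  open IsMarginal marginal hiding (symmetric)
  open Integration em R ℙ using (zeroBelow)
  open Integrals em R ℙ

  time : Fin n → ℕ
  time v = toℕ (σ ⟨$⟩ˡ v)

  time-arriving : ∀ {k} (k<n : k ℕ.< n) → time (arriving 𝐫 k<n) ≡ k
  time-arriving k<n = trans (cong toℕ (inverseˡ σ)) (toℕ-fromℕ< k<n)

  time-arrived : ∀ {k} (k<n : k ℕ.< n) i → time (arrived 𝐫 k<n i) ≡ toℕ i
  time-arrived k<n i = trans (cong toℕ (inverseˡ σ)) (toℕ-inject≤ i (ℕ.<⇒≤ k<n))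

  arrived-before : ∀ {k} (k<n : k ℕ.< n) i → time (arrived 𝐫 k<n i) ℕ.< time (arriving 𝐫 k<n)
  arrived-before k<n i = subst₂ ℕ._<_ (sym (time-arrived k<n i)) (sym (time-arriving k<n)) (toℕ<n i)

  -- Expectations are given only in the direction of arrival, so the order of u and v selects the
  -- orientation, and equal times would be a loop. The empty simple function supplies the lower
  -- bound 0.
  x-nonneg : ∀ u v → 0ℝ ≤ x u v
  x-nonneg u v with dec (Edge u v)
  ... | no ¬uv = ≤-reflexive (sym (non-edge u v ¬uv))
  ... | yes uv with ℕ.<-cmp (time u) (time v)
  ...   | tri< u<v _ _ = proj₁ (expectation u v (uv , u<v)) (zeroBelow , refl)
  ...   | tri> _ _ v<u = subst (0ℝ ≤_) (IsMarginal.symmetric marginal v u)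
            (proj₁ (expectation v u (subst T (symmetric u v) uv , v<u)) (zeroBelow , refl))
  ...   | tri≈ _ u≈v _ = ⊥-elim (subst T (trans (cong (adjacent u) (sym u≡v)) (irreflexive u)) uv)
    where
    u≡v : u ≡ v
    u≡v = trans (sym (inverseʳ σ)) (trans (cong (σ ⟨$⟩ʳ_) (toℕ-injective u≈v)) (inverseʳ σ))

  x-diagonal : ∀ v → x v v ≡ 0ℝ
  x-diagonal v = non-edge v v (subst T (irreflexive v))

  -- On a non-edge both the coordinate and x vanish; sums over all arrived vertices then need no
  -- case distinction.
  r-expectation : ∀ {u v} → time u ℕ.< time v → IsExpectation ℙ (λ ω → r v ω u) (x u v)
  r-expectation {u} {v} u<v with dec (Edge u v)
  ... | yes uv = expectation u v (uv , u<v)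
  ... | no ¬uv = isIntegral (λ ω → RandomBatches.nonneg 𝐫 v ω u) (Int-cong
          (λ ω → sym (trans (cong (_* _) (off-batch v ω u (¬uv ∘ proj₁))) (zeroˡ _)))
          (sym (non-edge u v ¬uv)) Int-0)

  mean-arrival : ∀ {k} (k<n : k ℕ.< n) i →
                 mean (arrival 𝐫 k<n) i ≡ x (arrived 𝐫 k<n i) (arriving 𝐫 k<n)
  mean-arrival k<n i = mean-unique (arrival 𝐫 k<n) i
    (PushForward.law-expectation em R ℙ {f = batchVector 𝐫 k<n}
      (λ j → measurable (arriving 𝐫 k<n) (arrived 𝐫 k<n j)) i
      (λ ω → RandomBatches.nonneg 𝐫 _ ω _) (λ ω → ≤1 _ ω _)
      (r-expectation (arrived-before k<n i)))

  private
    X : Fin n → Fin n → ℝ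
    X i j = x (σ ⟨$⟩ʳ i) (σ ⟨$⟩ʳ j)

    Σ-snoc : ∀ {k} (k<n : k ℕ.< n) j → sum {suc k} (λ z → X (inject≤ z k<n) j) ≡
             sum {k} (λ z → X (inject≤ z (ℕ.<⇒≤ k<n)) j) + X (fromℕ< k<n) j
    Σ-snoc {k} k<n j = trans (sum-init-last (λ z → X (inject≤ z k<n) j))
      (cong₂ _+_ (sum-cong-≗ (λ z → cong (λ i → X i j) (inject≤-inject₁ z k<n)))
                 (cong (λ i → X i j) (inject≤-fromℕ k<n)))

    -- A new arrival costs each older vertex half of their common marginal and itself half of the
    -- sum of these. Symmetry of x turns both into one formula, and the zero diagonal lets the sum
    -- include the vertex itself.
    freeProb-arrivals : ∀ {k} (k≤n : k ℕ.≤ n) (i : Fin k) → freeProb (arrivals 𝐫 k≤n) i ≡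
      1ℝ + - (½ * sum {k} (λ z → X (inject≤ z k≤n) (inject≤ i k≤n)))
    freeProb-arrivals {suc k} k<n i with view i
    ... | ‵fromℕ = trans (freeProb-fromℕ (arrivals 𝐫 (ℕ.<⇒≤ k<n)) (arrival 𝐫 k<n)) (cong (λ z → 1ℝ + - (½ * z)) (begin
        sum (mean (arrival 𝐫 k<n))
          ≡⟨ sum-cong-≗ (mean-arrival k<n) ⟩
        sum {k} (λ z → X (inject≤ z (ℕ.<⇒≤ k<n)) (fromℕ< k<n))
          ≡⟨ sym (+-identityʳ _) ⟩
        sum {k} (λ z → X (inject≤ z (ℕ.<⇒≤ k<n)) (fromℕ< k<n)) + 0ℝ
          ≡⟨ cong (sum {k} (λ z → X (inject≤ z (ℕ.<⇒≤ k<n)) (fromℕ< k<n)) +_) (sym (x-diagonal _)) ⟩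
        sum {k} (λ z → X (inject≤ z (ℕ.<⇒≤ k<n)) (fromℕ< k<n)) + X (fromℕ< k<n) (fromℕ< k<n)
          ≡⟨ sym (Σ-snoc k<n (fromℕ< k<n)) ⟩
        sum {suc k} (λ z → X (inject≤ z k<n) (fromℕ< k<n))
          ≡⟨ sum-cong-≗ (λ z → cong (X (inject≤ z k<n)) (sym (inject≤-fromℕ k<n))) ⟩
        sum {suc k} (λ z → X (inject≤ z k<n) (inject≤ (fromℕ k) k<n)) ∎))
      where open ≡-Reasoning
    ... | ‵inject₁ j = trans (freeProb-inject₁ (arrivals 𝐫 (ℕ.<⇒≤ k<n)) (arrival 𝐫 k<n) j) (begin
        freeProb (arrivals 𝐫 (ℕ.<⇒≤ k<n)) j + - (½ * mean (arrival 𝐫 k<n) j)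
          ≡⟨ cong₂ (λ p m → p + - (½ * m)) (freeProb-arrivals (ℕ.<⇒≤ k<n) j)
               (trans (mean-arrival k<n j) (IsMarginal.symmetric marginal _ _)) ⟩
        (1ℝ + - (½ * S)) + - (½ * X (fromℕ< k<n) j′)
          ≡⟨ solve 3 (λ h s y → (:1 :+ :- (h :* s)) :+ :- (h :* y) := :1 :+ :- (h :* (s :+ y))) refl
               ½ S (X (fromℕ< k<n) j′) ⟩
        1ℝ + - (½ * (S + X (fromℕ< k<n) j′))
          ≡⟨ cong (λ z → 1ℝ + - (½ * z)) (sym (Σ-snoc k<n j′)) ⟩
        1ℝ + - (½ * sum {suc k} (λ z → X (inject≤ z k<n) j′))
          ≡⟨ cong (λ i → 1ℝ + - (½ * sum {suc k} (λ z → X (inject≤ z k<n) i))) (sym (inject≤-inject₁ j k<n)) ⟩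
        1ℝ + - (½ * sum {suc k} (λ z → X (inject≤ z k<n) (inject≤ (inject₁ j) k<n))) ∎)
      where
      open ≡-Reasoning
      j′ = inject≤ j (ℕ.<⇒≤ k<n)
      S  = sum {k} (λ z → X (inject≤ z (ℕ.<⇒≤ k<n)) j′)

    -- Hypothesis (i) reindexed by arrival time; vertices yet to come are dropped because x is
    -- nonnegative.
    load-≤1 : ∀ {k} (k≤n : k ℕ.≤ n) j → sum {k} (λ z → X (inject≤ z k≤n) j) ≤ 1ℝ
    load-≤1 k≤n j = ≤-trans (sum-inject≤ (λ z → X z j) (λ z → x-nonneg _ _) k≤n)
      (≤-trans (≤-reflexive (sym (sum-permute (λ u → x u (σ ⟨$⟩ʳ j)) σ))) (Σx≤1 (σ ⟨$⟩ʳ j)))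

  freeProb-≤1 : ∀ {k} (k≤n : k ℕ.≤ n) i → freeProb (arrivals 𝐫 k≤n) i ≤ 1ℝ
  freeProb-≤1 {k} k≤n i = subst (_≤ 1ℝ) (sym (freeProb-arrivals k≤n i))
    (1-≤1 (*-nonneg 0≤½ (sum-nonneg {k} λ z → x-nonneg (σ ⟨$⟩ʳ inject≤ z k≤n) (σ ⟨$⟩ʳ inject≤ i k≤n))))

  freeProb-≥½ : ∀ {k} (k≤n : k ℕ.≤ n) i → ½ ≤ freeProb (arrivals 𝐫 k≤n) i
  freeProb-≥½ {k} k≤n i = subst (½ ≤_) (sym (freeProb-arrivals k≤n i)) (lin
    (*-monoˡ-≤ 0≤½ (load-≤1 k≤n (inject≤ i k≤n)))
    (trans (solve 1 (λ h → h :+ h :* :1 := h :+ h) refl ½) (trans ½+½≡1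
      (solve 2 (λ h s → :1 := (:1 :+ :- (h :* s)) :+ h :* s) refl ½ (sum {k} (λ z → X (inject≤ z k≤n) (inject≤ i k≤n)))))))

-- The run conditional on the realizations

module Run (em : ExcludedMiddle (lsuc 0ℓ)) (R : Reals)
  {n : ℕ} {G : Graph n} {σ : ArrivalOrder n} (𝐫 : VertexArrival.RandomBatches R G σ)
  {x : Fin n → Fin n → Reals.ℝ R} (marginal : VertexArrival.IsMarginal R 𝐫 x)
  (Σx≤1 : ∀ v → Reals._≤_ R (Reals.sum R (λ u → x u v)) (Reals.1ℝ R))
  (Σr≤1 : ∀ v ω → Reals._≤_ R (Reals.sum R (VertexArrival.RandomBatches.r 𝐫 v ω)) (Reals.1ℝ R)) where
  open Analysis em R
  open StickBreaking em R
  open FiniteSums em R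
  open SelectionSums em R
  open Algorithm em R
  open Reals R
  open Graph G
  open VertexArrival R
  open RandomBatches 𝐫 hiding (nonneg)
  open Marginals em R 𝐫 marginal Σx≤1

  ⟦_⟧ : Bool → ℝ
  ⟦ b ⟧ = if b then 1ℝ else 0ℝ

  ⟦⟧-nonneg : ∀ b → 0ℝ ≤ ⟦ b ⟧
  ⟦⟧-nonneg true  = 0≤1
  ⟦⟧-nonneg false = ≤-refl

  ⟦⟧-≤1 : ∀ b → ⟦ b ⟧ ≤ 1ℝ
  ⟦⟧-≤1 true  = ≤-refl
  ⟦⟧-≤1 false = 0≤1

  *-⟦⟧ : ∀ b y → y * ⟦ b ⟧ ≡ (if b then y else 0ℝ)
  *-⟦⟧ true  y = *-identityʳ y
  *-⟦⟧ false y = zeroʳ y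

  run : ∀ {k} → k ℕ.≤ n → Ω → Selections k → ℝ
  run = runProb 𝐫 algorithm

  -- The quantity F of the overview, after k arrivals.
  free-run : ∀ {k} → k ℕ.≤ n → Ω → Fin k → ℝ
  free-run {k} k≤n ω i = sumSelections k (λ I → run k≤n ω I * ⟦ free I i ⟧)

  run-nonneg : ∀ {k} (k≤n : k ℕ.≤ n) ω I → 0ℝ ≤ run k≤n ω I
  run-nonneg k≤n ω []      = 0≤1
  run-nonneg k<n ω (I ▷ D) = *-nonneg (run-nonneg (ℕ.<⇒≤ k<n) ω I)
    (OnlineAlgorithm.nonneg algorithm (arrivals 𝐫 k<n) (realizations 𝐫 k<n ω) I D)

  run-total : ∀ {k} (k≤n : k ℕ.≤ n) ω → sumSelections k (run k≤n ω) ≡ 1ℝ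
  run-total {zero}  k≤n ω = refl
  run-total {suc k} k<n ω = trans (sumSelections-cong k λ I →
      trans (sumSubsets-* k (run (ℕ.<⇒≤ k<n) ω I) _)
        (trans (cong (run (ℕ.<⇒≤ k<n) ω I *_)
                 (OnlineAlgorithm.total algorithm (arrivals 𝐫 k<n) (realizations 𝐫 k<n ω) I))
               (*-identityʳ _)))
    (run-total (ℕ.<⇒≤ k<n) ω)

  free-run-nonneg : ∀ {k} (k≤n : k ℕ.≤ n) ω i → 0ℝ ≤ free-run k≤n ω i
  free-run-nonneg {k} k≤n ω i = subst (_≤ free-run k≤n ω i)
    (trans (sumSelections-* k 0ℝ (λ _ → 0ℝ)) (zeroˡ _))
    (sumSelections-mono k λ I → subst (_≤ run k≤n ω I * ⟦ free I i ⟧) (sym (zeroˡ 0ℝ)) (*-nonneg (run-nonneg k≤n ω I) (⟦⟧-nonneg (free I i))))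

  free-run-≤1 : ∀ {k} (k≤n : k ℕ.≤ n) ω i → free-run k≤n ω i ≤ 1ℝ
  free-run-≤1 {k} k≤n ω i = subst (free-run k≤n ω i ≤_) (run-total k≤n ω)
    (sumSelections-mono k λ I → subst (run k≤n ω I * ⟦ free I i ⟧ ≤_) (*-identityʳ _)
      (*-monoˡ-≤ (run-nonneg k≤n ω I) (⟦⟧-≤1 (free I i))))

  module Step {k} (k<n : k ℕ.< n) where

    before : Prefix Arrival k
    before = arrivals 𝐫 (ℕ.<⇒≤ k<n)

    now : Arrival k
    now = arrival 𝐫 k<n

    α : Fin k → ℝ
    α i = acceptance (freeProb before i)

    s : Ω → Vector ℝ k
    s = batchVector 𝐫 k<n

    s-nonneg : ∀ ω i → 0ℝ ≤ s ω i
    s-nonneg ω i = RandomBatches.nonneg 𝐫 _ ω _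

    α-≤1 : ∀ i → α i ≤ 1ℝ
    α-≤1 i = acceptance-≤1 (freeProb-≥½ (ℕ.<⇒≤ k<n) i)

    α-freeProb : ∀ i → α i * freeProb before i ≡ ½
    α-freeProb i = acceptance-* (freeProb-≥½ (ℕ.<⇒≤ k<n) i)

    w : Ω → Selections k → Vector ℝ k
    w ω I = weight before now I (s ω)

    gain-≡ : ∀ I i → Edge (arrived 𝐫 k<n i) (arriving 𝐫 k<n) → gain before now I i ≡ α i * ⟦ free I i ⟧
    gain-≡ I i uv rewrite lookup∘tabulate (λ i → adjacent (arrived 𝐫 k<n i) (arriving 𝐫 k<n)) i
      with adjacent (arrived 𝐫 k<n i) (arriving 𝐫 k<n) | uv
    ... | true | _ = sym (*-⟦⟧ (free I i) (α i))

    -- Off the batch the realized coordinate is 0, so the formula without the batch test holds for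
    -- every earlier vertex.
    w-≡ : ∀ ω I i → w ω I i ≡ ⟦ free I i ⟧ * (α i * s ω i)
    w-≡ ω I i with dec (Edge (arrived 𝐫 k<n i) (arriving 𝐫 k<n))
    ... | yes uv = trans (cong₂ _*_ (⁺-id (s-nonneg ω i)) (gain-≡ I i uv))
        (solve 3 (λ s a b → s :* (a :* b) := b :* (a :* s)) refl (s ω i) (α i) ⟦ free I i ⟧)
    ... | no ¬uv = trans (cong (λ z → z ⁺ * gain before now I i) s≡0)
        (trans (cong (_* gain before now I i) (⁺-id ≤-refl)) (trans (zeroˡ _)
          (sym (trans (cong (λ z → ⟦ free I i ⟧ * (α i * z)) s≡0)
            (solve 2 (λ a b → b :* (a :* :0) := :0) refl (α i) ⟦ free I i ⟧)))))
      where
      s≡0 : s ω i ≡ 0ℝ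
      s≡0 = off-batch _ ω _ (¬uv ∘ proj₁)

    Σs≤1 : ∀ ω → sum (s ω) ≤ 1ℝ
    Σs≤1 ω = ≤-trans (sum-inject≤ (λ z → r (arriving 𝐫 k<n) ω (σ ⟨$⟩ʳ z)) (λ z → RandomBatches.nonneg 𝐫 _ ω _) (ℕ.<⇒≤ k<n))
      (≤-trans (≤-reflexive (sym (sum-permute (r (arriving 𝐫 k<n) ω) σ))) (Σr≤1 (arriving 𝐫 k<n) ω))

    w-nonneg : ∀ ω I i → 0ℝ ≤ w ω I i
    w-nonneg ω I = weight-nonneg before now I (s ω)

    -- Combines (ii) with acceptance probabilities at most 1, which come from (i); `stick` therefore
    -- never truncates during a run.
    Σw≤1 : ∀ ω I → sum (w ω I) ≤ 1ℝ
    Σw≤1 ω I = ≤-trans (sum-mono λ i → subst (_≤ s ω i) (sym (w-≡ ω I i))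
        (≤-trans (*≤ˡ (*-nonneg (acceptance-nonneg _) (s-nonneg ω i)) (⟦⟧-≤1 (free I i)))
                 (*≤ˡ (s-nonneg ω i) (α-≤1 i))))
      (Σs≤1 ω)

    p : Ω → Selections k → Subset k → ℝ
    p ω I = stick 1ℝ (w ω I)

    weighted : ∀ ω I (h : Subset k → Bool) {y} →
      sumSubsets k (λ D → if h D then p ω I D else 0ℝ) ≡ y →
      sumSubsets k (λ D → if h D then run k<n ω (I ▷ D) else 0ℝ) ≡ run (ℕ.<⇒≤ k<n) ω I * y
    weighted ω I h e = trans (sumSubsets-cong k λ D → pull (h D))
      (trans (sumSubsets-* k (run (ℕ.<⇒≤ k<n) ω I) _) (cong (run (ℕ.<⇒≤ k<n) ω I *_) e))
      where
      pull : ∀ b {a c} → (if b then a * c else 0ℝ) ≡ a * (if b then c else 0ℝ)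
      pull true  = refl
      pull false = sym (zeroʳ _)

    -- The history I enters the weight of i only through the indicator that i is free, so summing
    -- over histories turns that indicator into F.
    selectProb-≡ : ∀ i ω → selectProb 𝐫 algorithm k<n i ω ≡ free-run (ℕ.<⇒≤ k<n) ω i * (α i * s ω i)
    selectProb-≡ i ω = trans (sumSelections-cong k λ I →
        trans (weighted ω I (λ D → lookup D i) (trans (stick-singleton (w-nonneg ω I) (Σw≤1 ω I) i) (w-≡ ω I i)))
          (solve 3 (λ a b q → a :* (b :* q) := q :* (a :* b)) refl
            (run (ℕ.<⇒≤ k<n) ω I) ⟦ free I i ⟧ (α i * s ω i)))
      (trans (sumSelections-* k (α i * s ω i) _) (*-comm _ _))

    -- The new vertex stays free with probability 1 minus its total weight, which is linear in the
    -- indicators of the older vertices.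
    free-run-fromℕ : ∀ ω → free-run k<n ω (fromℕ k) ≡
      1ℝ + - sum (λ j → free-run (ℕ.<⇒≤ k<n) ω j * (α j * s ω j))
    free-run-fromℕ ω = begin
      free-run k<n ω (fromℕ k)
        ≡⟨ sumSelections-cong k (λ I → trans (sumSubsets-cong k (λ D → trans
             (cong (λ b → run k<n ω (I ▷ D) * ⟦ b ⟧)
               (snoc-fromℕ (λ i → free I i ∧ not (lookup D i)) (isEmpty D)))
             (*-⟦⟧ (isEmpty D) _)))
             (weighted ω I isEmpty (stick-empty (w-nonneg ω I) (Σw≤1 ω I)))) ⟩
      sumSelections k (λ I → ρ I * (1ℝ + - sum (w ω I)))
        ≡⟨ sumSelections-cong k (λ I → trans
             (solve 2 (λ a b → a :* (:1 :+ :- b) := a :+ :- :1 :* (a :* b)) refl (ρ I) (sum (w ω I)))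
             (cong (λ z → ρ I + - 1ℝ * z) (trans (*-distribˡ-sum (ρ I) (w ω I)) (sum-cong-≗ (term≡ I))))) ⟩
      sumSelections k (λ I → ρ I + - 1ℝ * sum (λ j → q j * (ρ I * ⟦ free I j ⟧)))
        ≡⟨ trans (sumSelections-+ k ρ _) (cong₂ _+_ (run-total (ℕ.<⇒≤ k<n) ω) (sumSelections-* k (- 1ℝ) _)) ⟩
      1ℝ + - 1ℝ * sumSelections k (λ I → sum (λ j → q j * (ρ I * ⟦ free I j ⟧)))
        ≡⟨ cong (λ z → 1ℝ + - 1ℝ * z) (trans (sumSelections-sum k (λ j I → q j * (ρ I * ⟦ free I j ⟧)))
             (sum-cong-≗ (λ j → trans (sumSelections-* k (q j) _) (*-comm _ _)))) ⟩
      1ℝ + - 1ℝ * S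
        ≡⟨ solve 1 (λ z → :1 :+ :- :1 :* z := :1 :+ :- z) refl S ⟩
      1ℝ + - S ∎
      where
      open ≡-Reasoning
      ρ : Selections k → ℝ
      ρ = run (ℕ.<⇒≤ k<n) ω
      q : Fin k → ℝ
      q j = α j * s ω j
      S : ℝ
      S = sum (λ j → free-run (ℕ.<⇒≤ k<n) ω j * (α j * s ω j))
      term≡ : ∀ I j → ρ I * w ω I j ≡ q j * (ρ I * ⟦ free I j ⟧)
      term≡ I j = trans (cong (ρ I *_) (w-≡ ω I j))
        (solve 3 (λ a b q → a :* (b :* q) := q :* (a :* b)) refl (ρ I) ⟦ free I j ⟧ (q j))

    -- Staying free has the indicator ⟦free⟧ - ⟦free⟧ ⟦i ∈ D⟧; the weight of i contributes one more
    -- factor ⟦free⟧, absorbed by idempotence.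
    free-run-inject₁ : ∀ ω i → free-run k<n ω (inject₁ i) ≡
      free-run (ℕ.<⇒≤ k<n) ω i + - (free-run (ℕ.<⇒≤ k<n) ω i * (α i * s ω i))
    free-run-inject₁ ω i = begin
      free-run k<n ω (inject₁ i)
        ≡⟨ sumSelections-cong k (λ I → sumSubsets-cong k (λ D → trans
             (cong (λ b → run k<n ω (I ▷ D) * ⟦ b ⟧)
               (snoc-inject₁ (λ i → free I i ∧ not (lookup D i)) (isEmpty D) i))
             (split (free I i) (lookup D i) _))) ⟩
      sumSelections k (λ I → sumSubsets k (λ D → ⟦ free I i ⟧ * run k<n ω (I ▷ D)
        + - ⟦ free I i ⟧ * (if lookup D i then run k<n ω (I ▷ D) else 0ℝ)))
        ≡⟨ sumSelections-cong k (λ I → trans (sumSubsets-+ k _ _) (cong₂ _+_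
             (trans (sumSubsets-* k ⟦ free I i ⟧ _) (cong (⟦ free I i ⟧ *_)
               (trans (sumSubsets-* k (ρ I) (p ω I)) (cong (ρ I *_) (stick-total 1ℝ (w ω I))))))
             (trans (sumSubsets-* k (- ⟦ free I i ⟧) _) (cong (- ⟦ free I i ⟧ *_)
               (weighted ω I (λ D → lookup D i)
                 (trans (stick-singleton (w-nonneg ω I) (Σw≤1 ω I) i) (w-≡ ω I i))))))) ⟩
      sumSelections k (λ I → ⟦ free I i ⟧ * (ρ I * 1ℝ) + - ⟦ free I i ⟧ * (ρ I * (⟦ free I i ⟧ * q)))
        ≡⟨ sumSelections-cong k (λ I → idempotent (free I i) (ρ I)) ⟩
      sumSelections k (λ I → ρ I * ⟦ free I i ⟧ + - q * (ρ I * ⟦ free I i ⟧))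
        ≡⟨ trans (sumSelections-+ k _ _) (cong (F +_) (sumSelections-* k (- q) _)) ⟩
      F + - q * F
        ≡⟨ solve 2 (λ f q → f :+ :- q :* f := f :+ :- (f :* q)) refl F q ⟩
      F + - (F * q) ∎
      where
      open ≡-Reasoning
      ρ : Selections k → ℝ
      ρ = run (ℕ.<⇒≤ k<n) ω
      F q : ℝ
      F = free-run (ℕ.<⇒≤ k<n) ω i
      q = α i * s ω i
      split : ∀ b c y → y * ⟦ b ∧ not c ⟧ ≡ ⟦ b ⟧ * y + - ⟦ b ⟧ * (if c then y else 0ℝ)
      split false c     y = solve 2 (λ y z → y :* :0 := :0 :* y :+ :- :0 :* z) refl y (if c then y else 0ℝ)
      split true  false y = solve 1 (λ y → y :* :1 := :1 :* y :+ :- :1 :* :0) refl y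
      split true  true  y = solve 1 (λ y → y :* :0 := :1 :* y :+ :- :1 :* y) refl y
      idempotent : ∀ b y → ⟦ b ⟧ * (y * 1ℝ) + - ⟦ b ⟧ * (y * (⟦ b ⟧ * q)) ≡ y * ⟦ b ⟧ + - q * (y * ⟦ b ⟧)
      idempotent true  y = solve 2 (λ y q → :1 :* (y :* :1) :+ :- :1 :* (y :* (:1 :* q)) := y :* :1 :+ :- q :* (y :* :1)) refl y q
      idempotent false y = solve 2 (λ y q → :0 :* (y :* :1) :+ :- :0 :* (y :* (:0 :* q)) := y :* :0 :+ :- q :* (y :* :0)) refl y q

-- Independence along the run and the guarantee

module Guarantee (em : ExcludedMiddle (lsuc 0ℓ)) (R : Reals)
  {n : ℕ} {G : Graph n} {σ : ArrivalOrder n} (𝐫 : VertexArrival.RandomBatches R G σ)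
  {x : Fin n → Fin n → Reals.ℝ R} (marginal : VertexArrival.IsMarginal R 𝐫 x)
  (Σx≤1 : ∀ v → Reals._≤_ R (Reals.sum R (λ u → x u v)) (Reals.1ℝ R))
  (Σr≤1 : ∀ v ω → Reals._≤_ R (Reals.sum R (VertexArrival.RandomBatches.r 𝐫 v ω)) (Reals.1ℝ R)) where
  open Analysis em R
  open Nearness em R
  open FiniteSums em R
  open Algorithm em R
  open Reals R
  open VertexArrival R
  open Probability R using (module SigmaAlgebra; IsIntegral; Borel; preimage; gen)
  open RandomBatches 𝐫 hiding (nonneg)
  open Marginals em R 𝐫 marginal Σx≤1
  open Run em R 𝐫 marginal Σx≤1 Σr≤1
  open Independence em R 𝐫
  open SimpleFunctions em R ℱ using (𝟙; 𝟙-∈)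
  open Integrals em R ℙ
  open SigmaAlgebra using (Measurable)

  Before : ℕ → Pred (Fin n) 0ℓ
  Before k v = time v ℕ.< k

  Before-suc : ∀ {k} → Before k ⊆ Before (suc k)
  Before-suc = ℕ.m<n⇒m<1+n

  module _ {k} (k<n : k ℕ.< n) where
    arriving-≤ : Before (suc k) (arriving 𝐫 k<n)
    arriving-≤ = subst (ℕ._< suc k) (sym (time-arriving k<n)) (ℕ.n<1+n k)

    arriving-≮ : ¬ Before k (arriving 𝐫 k<n)
    arriving-≮ p = ℕ.<-irrefl (time-arriving k<n) p

  coordinate-approximated : ∀ v u {A} (mA : Measurable (Borel n) A) {p} →
    IsIntegral ℙ (A ∘ r v) (λ ω → r v ω u) p → Approximated v (λ ω → r v ω u * 𝟙 (A ∘ r v) ω) p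
  coordinate-approximated v u mA int 0<ε =
    let φ , near , near-p , _ = PushForward.layers-integral em R ℙ {f = r v} (measurable v) u
          (λ ω → RandomBatches.nonneg 𝐫 v ω u) (λ ω → ≤1 v ω u) mA int 0<ε
    in φ , near , near-p

  Approximated-cong : ∀ {v g h d e} → (∀ ω → g ω ≡ h ω) → d ≡ e → Approximated v g d → Approximated v h e
  Approximated-cong g≗h d≡e approx 0<ε with approx 0<ε
  ... | φ , near , near-e = φ , (λ ω → subst (λ z → Near _ z _) (g≗h ω) (near ω)) ,
    subst (λ z → Near _ z _) d≡e near-e

  mean-approximated : ∀ {k} (k<n : k ℕ.< n) i →
    Approximated (arriving 𝐫 k<n) (λ ω → r (arriving 𝐫 k<n) ω (arrived 𝐫 k<n i)) (mean (arrival 𝐫 k<n) i)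
  mean-approximated k<n i = Approximated-cong
    (λ ω → trans (cong (r (arriving 𝐫 k<n) ω (arrived 𝐫 k<n i) *_) (𝟙-∈ {U} {ω} _)) (*-identityʳ _))
    (sym (mean-arrival k<n i))
    (coordinate-approximated (arriving 𝐫 k<n) (arrived 𝐫 k<n i) {U}
      (SigmaAlgebra.universe (Borel n)) (r-expectation (arrived-before k<n i)))

  -- Mutual induction with `offer-independent`: F before an arrival involves earlier vectors only,
  -- and both recursions for F combine its products with the new coordinates linearly. `freeProb`
  -- obeys the same recursions.
  free-run-independent : ∀ {k} (k≤n : k ℕ.≤ n) i →
    IndependentOutside (Before k) (λ ω → free-run k≤n ω i) (freeProb (arrivals 𝐫 k≤n) i)

  -- h is left general: the recursions use the bare coordinate, the conditional probability uses it
  -- restricted to an event.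
  offer-independent : ∀ {k} (k<n : k ℕ.< n) i {h e} → Approximated (arriving 𝐫 k<n) h e →
    IndependentOutside (Before (suc k)) (λ ω → free-run (ℕ.<⇒≤ k<n) ω i * h ω)
      (freeProb (arrivals 𝐫 (ℕ.<⇒≤ k<n)) i * e)
  offer-independent k<n i = Ind-multiply Before-suc (arriving-≤ k<n) (arriving-≮ k<n)
    (free-run-independent (ℕ.<⇒≤ k<n) i)
    (λ ω → free-run-nonneg (ℕ.<⇒≤ k<n) ω i) (λ ω → free-run-≤1 (ℕ.<⇒≤ k<n) ω i)
    (≤-trans 0≤½ (freeProb-≥½ (ℕ.<⇒≤ k<n) i)) (freeProb-≤1 (ℕ.<⇒≤ k<n) i)

  half : ∀ {k} (k<n : k ℕ.< n) i y →
    acceptance (freeProb (arrivals 𝐫 (ℕ.<⇒≤ k<n)) i) * (freeProb (arrivals 𝐫 (ℕ.<⇒≤ k<n)) i * y) ≡ ½ * y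
  half k<n i y = trans (sym (*-assoc _ _ y)) (cong (_* y) (Step.α-freeProb k<n i))

  free-run-independent {suc k} k<n i with view i
  ... | ‵inject₁ j = Ind-cong
    (λ ω → trans (solve 3 (λ f a s → f :+ :- a :* (f :* s) := f :+ :- (f :* (a :* s))) refl
                    (free-run (ℕ.<⇒≤ k<n) ω j) (α j) (s ω j))
                 (sym (free-run-inject₁ ω j)))
    (trans (cong (d +_) (trans (solve 3 (λ a d m → :- a :* (d :* m) := :- (a :* (d :* m))) refl (α j) d m)
                               (cong -_ (half k<n j m))))
           (sym (freeProb-inject₁ before now j)))
    (Ind-+ (Ind-⊆ Before-suc (free-run-independent (ℕ.<⇒≤ k<n) j))
           (Ind-* (- α j) (offer-independent k<n j (mean-approximated k<n j))))
    where
    open Step k<n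
    d m : ℝ
    d = freeProb before j
    m = mean now j
  ... | ‵fromℕ = Ind-cong
    (λ ω → trans (trans (cong (λ z → 1ℝ + - 1ℝ * z) (sum-cong-≗ λ j →
                    solve 3 (λ f a s → a :* (f :* s) := f :* (a :* s)) refl
                      (free-run (ℕ.<⇒≤ k<n) ω j) (α j) (s ω j)))
                  (minus _))
                 (sym (free-run-fromℕ ω)))
    (trans (trans (cong (λ z → 1ℝ + - 1ℝ * z) (trans (sum-cong-≗ λ j → half k<n j (mean now j))
                    (sym (*-distribˡ-sum ½ (mean now)))))
                  (minus _))
           (sym (freeProb-fromℕ before now)))
    (Ind-+ Ind-1 (Ind-* (- 1ℝ) (Ind-sum λ j →
      Ind-* (α j) (offer-independent k<n j (mean-approximated k<n j)))))
    where
    open Step k<n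
    minus : ∀ z → 1ℝ + - 1ℝ * z ≡ 1ℝ + - z
    minus = solve 1 (λ z → :1 :+ :- :1 :* z := :1 :+ :- z) refl

  module _ {k} (k<n : k ℕ.< n) (i : Fin k) where
    open Step k<n

    -- A version must be nonnegative everywhere, also at vectors that 𝐫ᵛ never takes; hence the
    -- positive part.
    conditional : Vector ℝ k → ℝ
    conditional t = t i ⁺ * ½

    isConditionalProb : IsConditionalProb 𝐫 algorithm k<n i conditional
    isConditionalProb = record
      { measurable-g = MeasurableSets.*-measurable em R (Borel k) 0≤½
                         (MeasurableSets.⁺-measurable em R (Borel k) (gen i))
      ; nonneg-g     = λ t → *-nonneg (⁺-nonneg (t i)) 0≤½
      ; version      = version
      }
      where
      version : ∀ {A} → Measurable (Borel k) A →
        ∃[ p ] IsIntegral ℙ (A ∘ s) (selectProb 𝐫 algorithm k<n i) p × IsIntegral ℙ (A ∘ s) (conditional ∘ s) p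
      -- Here e is the integral of the coordinate over the event; both sides equal half of it.
      version {A} mA = ½ * e , isIntegral selectProb-nonneg selectProb-Int
                             , isIntegral (λ ω → *-nonneg (⁺-nonneg (s ω i)) 0≤½) conditional-Int
        where
        integral = integral-exists {A ∘ s} (λ ω → s-nonneg ω i) (λ ω → ≤1 _ ω _)
        e : ℝ
        e = proj₁ integral
        approximated : Approximated (arriving 𝐫 k<n) (λ ω → s ω i * 𝟙 (A ∘ s) ω) e
        approximated = coordinate-approximated (arriving 𝐫 k<n) (arrived 𝐫 k<n i)
          -- The event about the first k arrivals becomes one about the full vector in n
          -- coordinates, for which independence is stated.
          (preimage (Borel n) (λ j → gen (arrived 𝐫 k<n j)) mA) (proj₂ integral)
        selectProb-nonneg : ∀ ω → 0ℝ ≤ selectProb 𝐫 algorithm k<n i ω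
        selectProb-nonneg ω = subst (0ℝ ≤_) (sym (selectProb-≡ i ω))
          (*-nonneg (free-run-nonneg (ℕ.<⇒≤ k<n) ω i) (*-nonneg (acceptance-nonneg _) (s-nonneg ω i)))
        selectProb-Int : Int (λ ω → selectProb 𝐫 algorithm k<n i ω * 𝟙 (A ∘ s) ω) (½ * e)
        selectProb-Int = Int-cong
          (λ ω → trans (solve 4 (λ a f s o → a :* (f :* (s :* o)) := (f :* (a :* s)) :* o) refl
                          (α i) (free-run (ℕ.<⇒≤ k<n) ω i) (s ω i) (𝟙 (A ∘ s) ω))
                       (cong (_* 𝟙 (A ∘ s) ω) (sym (selectProb-≡ i ω))))
          (half k<n i e)
          (Int-* (α i) (Ind-Int (offer-independent k<n i approximated)))
        conditional-Int : Int (λ ω → conditional (s ω) * 𝟙 (A ∘ s) ω) (½ * e)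
        conditional-Int = Int-cong
          (λ ω → trans (solve 3 (λ h s o → h :* (:1 :* (s :* o)) := (s :* h) :* o) refl ½ (s ω i) (𝟙 (A ∘ s) ω))
                       (cong (λ z → z * ½ * 𝟙 (A ∘ s) ω) (sym (⁺-id (s-nonneg ω i)))))
          (cong (½ *_) (*-identityˡ e))
          -- The constant 1 takes the place of F, which leaves the integral of the coordinate
          -- itself.
          (Int-* ½ (Ind-Int (Ind-multiply {S = Before k} Before-suc (arriving-≤ k<n) (arriving-≮ k<n) Ind-1
            (λ _ → 0≤1) (λ _ → ≤-refl) 0≤1 ≤-refl approximated)))

  selectable : Selectable 𝐫 algorithm ½
  -- The inequality holds at every vector, so the exceptional null set is empty.
  selectable {k} k<n i _ = conditional k<n i , isConditionalProb k<n i , ∅ ,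
    MeasurableSets.∅-measurable em R (Borel k) ,
    Measure.P-∅ em R (batchLaw 𝐫 k<n) {∅} (MeasurableSets.∅-measurable em R (Borel k)) (λ _ ()) ,
    λ s _ → subst (_≤ s i ⁺ * ½) (*-comm (s i) ½) (*-monoʳ-≤ 0≤½ (≤⁺ (s i)))

theoremC1 :
    ExcludedMiddle (lsuc 0ℓ) →
    (R : Reals) →
    let open Reals R
        open VertexArrival R
    in
    Σ[ alg ∈ OnlineAlgorithm ]
      (∀ {n : ℕ} (G : Graph n) (σ : ArrivalOrder n) (𝐫 : RandomBatches G σ)
         (x : Fin n → Fin n → ℝ) → IsMarginal 𝐫 x →
       (∀ v → sum (λ u → x u v) ≤ 1ℝ) →
       (∀ v ω → sum (λ u → RandomBatches.r 𝐫 v ω u) ≤ 1ℝ) →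
       Selectable 𝐫 alg ½)
theoremC1 em R = Algorithm.algorithm em R , λ G σ 𝐫 x marginal Σx≤1 Σr≤1 →
  Guarantee.selectable em R 𝐫 marginal Σx≤1 Σr≤1
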